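{- Let $(X,\mathrm{d}x)$ be a measure space and $f:X\to[0,\infty]$ a measurable function. For $p\in(0,\infty)$ and $x^*\in X$ let $$(p\text{ - }\mathrm{softmax}\, f)(x^*) := \left(\int_{x\in X} \big((f(x)\multimap f(x^*))^*\big)^p\,\mathrm{d}x\right)^{*\,1/p},$$ where $(\cdot)^{*\,1/p}$ means: apply the duality $(-)^*$ and then raise to the power $1/p$ (this is the multiplicative semantics of the sentence $\forall^p(x\in X).\, f(x)\multimap f(x^*)$), and for $p=\infty$ let $$(\infty\text{ - }\mathrm{softmax}\, f)(x^*) := \bigwedge_{x\in X} \big(f(x)\multimap f(x^*)\big).$$ Then: (1) for every $p\in(0,\infty)$ and every $x^*\in X$, $$(p\text{ - }\mathrm{softmax}\, f)(x^*) = \left(\int_{x\in X} f(x)^p\,\mathrm{d}x\right)^{1/p}\multimap f(x^*),\qquad\text{i.e. } \frac{f(x^*)}{\left(\int_{x\in X} f(x)^p\,\mathrm{d}x\right)^{1/p}};$$ (2) for $p=1$ this is the softmax of $f$: for every $x^*\in X$, $$(1\text{ - }\mathrm{softmax}\, f)(x^*) = (\mathrm{softmax}\, f)(x^*);$$ (3) for $p=\infty$ it recovers argmax through the unitary separator: for every $x^*\in X$, $$\lfloor(\infty\text{ - }\mathrm{softmax}\, f)(x^*)\rfloor = (\mathrm{argmax}\, f)(x^*),$$ i.e. $(\infty\text{ - }\mathrm{softmax}\, f)(x^*)\ge 1$ if and only if $f(x)\le f(x^*)$ for all $x\in X$.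
   Context: Truth values are elements of $[0,\infty]$ with its usual order; $\bigwedge$ denotes infimum. Duality: $a^*:=1/a$ for $0<a<\infty$, $0^*:=\infty$, $\infty^*:=0$. Division $a\multimap b$ (also written as the fraction $b/a$): it equals $b/a$ for $a\in(0,\infty)$ and $b\in[0,\infty)$; $0\multimap b=\infty$ for every $b$; $a\multimap\infty=\infty$ for every $a$; and $\infty\multimap b=0$ for $b<\infty$. (Equivalently, $a\multimap -$ is right adjoint to $-\otimes a$, where $\otimes$ is multiplication extended by $0\otimes\infty=0$ and $a\otimes\infty=\infty$ for $a>0$.) For exponents $k\in(0,\infty)$: $0^k=0$, $\infty^k=\infty$. Integrals are Lebesgue integrals of $[0,\infty]$-valued measurable functions, with values in $[0,\infty]$. For $p\in(0,\infty)$ the positive and negative $p$-integrals of $a:X\to[0,\infty]$ are $\int^{p}_{x\in X} a(x)\,\mathrm{d}x:=\left(\int_{x\in X} a(x)^p\,\mathrm{d}x\right)^{1/p}$ and $\int^{ -p}_{x\in X} a(x)\,\mathrm{d}x:=\left(\int^{p}_{x\in X} a(x)^*\,\mathrm{d}x\right)^*$. The soft universal quantifier $\forall^p$ is interpreted as $\int^{ -p}$; at $p=\infty$ it is interpreted as $\bigwedge$. The softmax of $f$ is $(\mathrm{softmax}\, f)(x^*):=\dfrac{f(x^*)}{\int_{x\in X} f(x)\,\mathrm{d}x}$, with the division convention above. The (Boolean) argmax predicate is $(\mathrm{argmax}\, f)(x^*):=\big(\forall x\in X,\ f(x)\le f(x^*)\big)$. The unitary separator $\lfloor-\rfloor$ sends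 $a\in[0,\infty]$ to true if $a\ge1$ and to false otherwise. -}

module Defs where

open import Axiom.ExcludedMiddle using (ExcludedMiddle)
open import Data.Bool.Base using (if_then_else_)
open import Data.Empty using (⊥-elim)
open import Data.Fin.Base using (Fin; toℕ)
import Data.Integer.Base as ℤ
open import Data.Nat.Base using (ℕ; zero; suc)
open import Data.Product.Base using (Σ-syntax; ∃-syntax; _×_; _,_)
open import Data.Rational.Base as ℚ using (ℚ; 0ℚ; 1ℚ)
import Data.Rational.Properties as ℚ
open import Data.Sum.Base using (_⊎_; inj₁; inj₂)
open import Data.Unit.Base using (⊤; tt)
open import Data.Vec.Functional using (foldr)
open import Level using (0ℓ)
open import Relation.Binary.PropositionalEquality using (_≡_; _≢_; refl; subst)
open import Relation.Nullary using (¬_; does)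
open import Relation.Unary using (Pred; U; ∅; ∁; ⋃; _≐_; _⊥_)

------------------------------------------------------------------------
-- The extended nonnegative reals
------------------------------------------------------------------------

-- An element a of [0,∞] is given by its lower cut {q ∈ ℚ | q < a}.  With
-- excluded middle this is exactly the usual [0,∞]: the cut of 0 is the
-- set of negative rationals, and the cut of ∞ is all of ℚ.

record [0,∞] : Set₁ where
  field
    cut      : ℚ → Set
    negative : ∀ {q} → q ℚ.< 0ℚ → cut q
    down     : ∀ {q r} → q ℚ.< r → cut r → cut q
    open′    : ∀ {q} → cut q → ∃[ r ] q ℚ.< r × cut r

infix 4 _◁_ _≤_ _<_ _≈_

-- q ◁ a says that the rational q is strictly less than a.
_◁_ : ℚ → [0,∞] → Set
q ◁ a = [0,∞].cut a q

_≤_ : [0,∞] → [0,∞] → Set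
a ≤ b = ∀ q → q ◁ a → q ◁ b

_<_ : [0,∞] → [0,∞] → Set
a < b = ¬ (b ≤ a)

_≈_ : [0,∞] → [0,∞] → Set
a ≈ b = (a ≤ b) × (b ≤ a)

-- The supremum in [0,∞] of a set of rationals (negative ones count as 0;
-- the supremum of the empty set is 0).
sup : (ℚ → Set) → [0,∞]
sup P = record
  { cut      = λ q → q ℚ.< 0ℚ ⊎ (∃[ r ] q ℚ.< r × P r)
  ; negative = inj₁
  ; down     = λ where
      q<r (inj₁ r<0)             → inj₁ (ℚ.<-trans q<r r<0)
      q<r (inj₂ (s , r<s , Ps)) → inj₂ (s , ℚ.<-trans q<r r<s , Ps)
  ; open′    = λ where
      (inj₁ q<0) →
        let (m , q<m , m<0) = ℚ.<-dense q<0 in m , q<m , inj₁ m<0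
      (inj₂ (s , q<s , Ps)) →
        let (m , q<m , m<s) = ℚ.<-dense q<s in m , q<m , inj₂ (s , m<s , Ps)
  }

⟨_⟩ : ℚ → [0,∞]
⟨ q ⟩ = sup (_≡ q)

0# 1# ∞# : [0,∞]
0# = ⟨ 0ℚ ⟩
1# = ⟨ 1ℚ ⟩
∞# = sup (λ _ → ⊤)

⋁ ⋀ : {I : Set} → (I → [0,∞]) → [0,∞]
⋁ a = sup (λ r → ∃[ i ] r ◁ a i)
⋀ a = sup (λ r → ∀ i → r ◁ a i)

infixl 6 _⊕_
infixl 7 _⊗_
infixl 9 _*
infixr 8 _^ℕ_ _^_

_⊕_ : [0,∞] → [0,∞] → [0,∞]
a ⊕ b = sup (λ r → ∃[ s ] ∃[ t ] s ◁ a × t ◁ b × r ≡ s ℚ.+ t)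

-- There is no s ≥ 0 with s ◁ 0#, so 0 ⊗ ∞ = ∞ ⊗ 0 = 0.
_⊗_ : [0,∞] → [0,∞] → [0,∞]
a ⊗ b = sup (λ r → ∃[ s ] ∃[ t ] (0ℚ ℚ.≤ s × s ◁ a) × (0ℚ ℚ.≤ t × t ◁ b) × r ≡ s ℚ.* t)

-- The duality: a * is the supremum of the 1/s with s > 0 rational and
-- s ≥ a.  This is 1/a for 0 < a < ∞; see 0* and ∞* below for the rest.
_* : [0,∞] → [0,∞]
a * = sup (λ r → ∃[ s ] 0ℚ ℚ.< s × ¬ (s ◁ a) × r ℚ.* s ≡ 1ℚ)

_^ℕ_ : [0,∞] → ℕ → [0,∞]
a ^ℕ zero  = 1#
a ^ℕ suc n = a ⊗ a ^ℕ n

-- Powers with a real exponent p ∈ (0,∞), as the supremum of the rational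
-- powers a^(m/n) over m/n ≤ p if a ≥ 1, and over m/n ≥ p if a ≤ 1 (where
-- t ↦ a^t is nonincreasing).  The condition r ≤ a^(m/n) is r^n ≤ a^m.
-- Values at p = 0 and p = ∞ carry no meaning.
_^_ : [0,∞] → [0,∞] → [0,∞]
a ^ p = sup (λ r → 0ℚ ℚ.≤ r × (Σ[ m ∈ ℕ ] Σ[ k ∈ ℕ ]
  let n = suc k
      t = ⟨ ℤ.+ m ℚ./ n ⟩
  in ((1# ≤ a × t ≤ p) ⊎ (a ≤ 1# × p ≤ t)) × ⟨ r ⟩ ^ℕ n ≤ a ^ℕ m))

∑ : ∀ {n} → (Fin n → [0,∞]) → [0,∞]
∑ = foldr _⊕_ 0#

∑∞ : (ℕ → [0,∞]) → [0,∞]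
∑∞ a = ⋁ λ N → ∑ {N} (λ i → a (toℕ i))

0* : 0# * ≈ ∞#
0* = fwd , bwd
  where
  fwd : 0# * ≤ ∞#
  fwd q (inj₁ q<0)           = inj₁ q<0
  fwd q (inj₂ (r , q<r , _)) = inj₂ (r , q<r , tt)

  ¬pos◁0 : ∀ {s} → 0ℚ ℚ.< s → ¬ (s ◁ 0#)
  ¬pos◁0 0<s (inj₁ s<0)              = ℚ.<-asym 0<s s<0
  ¬pos◁0 0<s (inj₂ (_ , s<0 , refl)) = ℚ.<-asym 0<s s<0

  pos : ∀ q r → q ℚ.< r → 0ℚ ℚ.< r → q ◁ 0# *
  pos q r q<r 0<r = inj₂ (r , q<r , ℚ.1/ r , 0<1/r , ¬pos◁0 0<1/r , ℚ.*-inverseʳ r)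
    where
    instance
      r-pos : ℚ.Positive r
      r-pos = ℚ.positive 0<r
      r≢0 : ℚ.NonZero r
      r≢0 = ℚ.pos⇒nonZero r
    0<1/r : 0ℚ ℚ.< ℚ.1/ r
    0<1/r = ℚ.positive⁻¹ (ℚ.1/ r) {{ℚ.1/pos⇒pos r}}

  bwd : ∞# ≤ 0# *
  bwd q (inj₁ q<0) = inj₁ q<0
  bwd q (inj₂ _) = pos q (1ℚ ℚ.+ (q ℚ.⊔ 0ℚ)) (step (ℚ.p≤p⊔q q 0ℚ)) (step (ℚ.p≤q⊔p q 0ℚ))
    where
    step : ∀ {x} → x ℚ.≤ q ℚ.⊔ 0ℚ → x ℚ.< 1ℚ ℚ.+ (q ℚ.⊔ 0ℚ)
    step {x} h = subst (ℚ._< 1ℚ ℚ.+ (q ℚ.⊔ 0ℚ)) (ℚ.+-identityˡ x)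
      (ℚ.+-mono-<-≤ (ℚ.positive⁻¹ 1ℚ) h)

∞* : ∞# * ≈ 0#
∞* = fwd , bwd
  where
  fwd : ∞# * ≤ 0#
  fwd q (inj₁ q<0) = inj₁ q<0
  fwd q (inj₂ (_ , _ , s , 0<s , s⋪∞ , _)) = ⊥-elim (s⋪∞ (inj₂ (s ℚ.+ 1ℚ ,
    subst (ℚ._< s ℚ.+ 1ℚ) (ℚ.+-identityʳ s) (ℚ.+-monoʳ-< s (ℚ.positive⁻¹ 1ℚ)) , tt)))

  bwd : 0# ≤ ∞# *
  bwd q (inj₁ q<0)              = inj₁ q<0
  bwd q (inj₂ (_ , q<0 , refl)) = inj₁ q<0

------------------------------------------------------------------------
-- Measure and Lebesgue integral
------------------------------------------------------------------------

record MeasureSpace : Set₂ where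
  field
    X          : Set
    Measurable : Pred X 0ℓ → Set
    -- Sets are identified with predicates up to pointwise equivalence.
    resp-≐     : ∀ {A B} → A ≐ B → Measurable A → Measurable B
    whole      : Measurable U
    complement : ∀ {A} → Measurable A → Measurable (∁ A)
    union      : ∀ {A : ℕ → Pred X 0ℓ} → (∀ n → Measurable (A n)) → Measurable (⋃ ℕ A)

    μ          : (A : Pred X 0ℓ) → Measurable A → [0,∞]
    -- In particular, μ A does not depend on the proof of measurability.
    μ-cong     : ∀ {A B} (mA : Measurable A) (mB : Measurable B) → A ≐ B → μ A mA ≈ μ B mB
    μ-∅        : (m∅ : Measurable ∅) → μ ∅ m∅ ≈ 0#
    μ-union    : ∀ {A : ℕ → Pred X 0ℓ} (mA : ∀ n → Measurable (A n)) →
                 (∀ i j → i ≢ j → A i ⊥ A j) →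
                 μ (⋃ ℕ A) (union mA) ≈ ∑∞ (λ n → μ (A n) (mA n))

module Integration (M : MeasureSpace) where
  open MeasureSpace M

  MeasurableFunction : (X → [0,∞]) → Set₁
  MeasurableFunction f = (a : [0,∞]) → Measurable (λ x → a < f x)

  -- A simple function: a finite measurable partition of X, the blocks
  -- being the fibres of label, with a nonnegative rational value on each
  -- block.
  record SimpleFunction : Set where
    field
      size    : ℕ
      label   : X → Fin size
      fibre   : ∀ i → Measurable (λ x → label x ≡ i)
      value   : Fin size → ℚ
      value≥0 : ∀ i → 0ℚ ℚ.≤ value i

    eval : X → [0,∞]
    eval x = ⟨ value (label x) ⟩

    integral : [0,∞]
    integral = ∑ λ i → ⟨ value i ⟩ ⊗ μ (λ x → label x ≡ i) (fibre i)

  -- The Lebesgue integral of a measurable f, as the supremum of the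
  -- integrals of the simple functions below f; rational values suffice,
  -- as every real-valued simple function is the supremum of an increasing
  -- sequence of rational-valued ones on the same partition.
  ∫ : (X → [0,∞]) → [0,∞]
  ∫ f = ⋁ {I = Σ[ s ∈ SimpleFunction ] (∀ x → SimpleFunction.eval s x ≤ f x)}
          (λ (s , _) → SimpleFunction.integral s)

------------------------------------------------------------------------
-- Division and softmax
------------------------------------------------------------------------

module Softmax (lem : ExcludedMiddle 0ℓ) (M : MeasureSpace) where
  open MeasureSpace M using (X)
  open Integration M public

  infixr 5 _⊸_

  _⊸_ : [0,∞] → [0,∞] → [0,∞]
  a ⊸ b =
    if does (lem {a ≈ 0#}) then ∞# else
    if does (lem {b ≈ ∞#}) then ∞# else
    if does (lem {a ≈ ∞#}) then 0# else
    b ⊗ a *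

  -- For p ∈ (0,∞), p * is 1/p.
  p-softmax : [0,∞] → (X → [0,∞]) → X → [0,∞]
  p-softmax p f x* = (∫ λ x → ((f x ⊸ f x*) *) ^ p) * ^ p *

  ∞-softmax : (X → [0,∞]) → X → [0,∞]
  ∞-softmax f x* = ⋀ λ x → f x ⊸ f x*

  softmax : (X → [0,∞]) → X → [0,∞]
  softmax f x* = ∫ f ⊸ f x*

  argmax : (X → [0,∞]) → X → Set
  argmax f x* = ∀ x → f x ≤ f x*

  -- The unitary separator, with truth values as propositions.
  ⌊_⌋ : [0,∞] → Set
  ⌊ a ⌋ = 1# ≤ a

{-# OPTIONS --safe #-}
module Submission where

-- The supremum defining `_^_` runs over fractions below `p` when `a ≥ 1` and above `p` when
-- `a ≤ 1`. For `a < 1 < b` the product `a · b` would mix the two kinds of approximation, so the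
-- multiplicativity needed to split off `b^(-p)` is awkward to read off the definition. The Eudoxus
-- bounds are two-sided and can be multiplied termwise. They determine `y` because two candidates
-- `y`, `z` satisfy `(y/z)^n ≤ a` for all `n`, which forces `y/z ≤ 1` when `a` is finite. The other
-- obstacle is `0 · ∞ = 0`. Multiplication preserves suprema, so limits from below pass through it
-- freely, but limits from above and the rule for the inverse of a product break at `0 · ∞`. Hence
-- the hypotheses that an element is invertible, and the three cases for `b`. At `b = 0` algebra is
-- not enough: a vanishing integral must force `f` to vanish off a null set, and there countable
-- additivity and the measurability of `f` enter.

-- Let b = f x*.  If 0 < b < ∞, the integrand ((f x ⊸ b)*)^p is f(x)^p · b^(-p), and the constant
-- leaves the integral.  If b = ∞ the integrand vanishes.  If b = 0 it is ∞ where f > 0 and 0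
-- elsewhere, so its integral is 0 or ∞ according to whether ∫ f^p = 0, because ∫ f^p = 0 makes
-- all the sets {f > 1/n} null.
--
-- The laws of powers come from the characterization of y = a^p for a ≥ 1 in the sense of Eudoxus:
-- a^m ≤ y^n if m/n ≤ p, and y^n ≤ a^m if p ≤ m/n.  It determines y, it is compatible with
-- products, and it is symmetric under exchanging (a, p) with (y, 1/p).  The case a ≤ 1 follows
-- by duality.

open import Defs
open import Algebra.Bundles using (CommutativeMonoid)
import Algebra.Properties.CommutativeMonoid.Mult as Mult
import Algebra.Properties.CommutativeSemigroup as CommutativeSemigroupProperties
open import Axiom.ExcludedMiddle using (ExcludedMiddle)
open import Data.Empty using (⊥-elim)
open import Data.Fin.Base using (Fin; zero; suc)
import Data.Integer.Base as ℤ
import Data.Integer.Properties as ℤ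
open import Data.Nat.Base as ℕ using (ℕ; zero; suc)
import Data.Nat.Properties as ℕ
open import Data.Product.Base using (Σ-syntax; ∃-syntax; _×_; _,_; proj₁; proj₂; swap)
open import Data.Rational.Base as ℚ using (ℚ; 0ℚ; 1ℚ; mkℚ)
import Data.Rational.Properties as ℚ
import Data.Rational.Unnormalised.Base as ℚᵘ
import Data.Rational.Unnormalised.Properties as ℚᵘ
open import Data.Sum.Base using (_⊎_; inj₁; inj₂)
open import Data.Unit.Base using (tt)
open import Function.Base using (_∘_)
open import Function.Bundles using (_⇔_; mk⇔)
open import Level using (0ℓ)
open import Relation.Binary.Bundles using (Poset)
open import Relation.Binary.Definitions using (tri<; tri≈; tri>)
open import Relation.Binary.PropositionalEquality
  using (_≡_; _≢_; refl; sym; trans; cong; subst; subst₂)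
import Relation.Binary.Reasoning.PartialOrder as PartialOrderReasoning
open import Relation.Nullary using (¬_; Dec; yes; no)
open import Relation.Unary using (Pred; ∅; ∁; ⋃; _≐_; _⊥_; _∩_; _⊆_)

-- Rational numbers

≤⇒≯ : ∀ {q r} → q ℚ.≤ r → ¬ (r ℚ.< q)
≤⇒≯ q≤r r<q = ℚ.<-irrefl refl (ℚ.≤-<-trans q≤r r<q)

*-mono-≤ : ∀ {q q′ r r′} → 0ℚ ℚ.≤ q → 0ℚ ℚ.≤ r′ → q ℚ.≤ q′ → r ℚ.≤ r′ → q ℚ.* r ℚ.≤ q′ ℚ.* r′
*-mono-≤ {q} {r′ = r′} 0≤q 0≤r′ q≤q′ r≤r′ = ℚ.≤-trans
  (ℚ.*-monoˡ-≤-nonNeg q {{ℚ.nonNegative 0≤q}} r≤r′)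
  (ℚ.*-monoʳ-≤-nonNeg r′ {{ℚ.nonNegative 0≤r′}} q≤q′)

*-mono-< : ∀ {q q′ r r′} → 0ℚ ℚ.≤ q → 0ℚ ℚ.≤ r → q ℚ.< q′ → r ℚ.< r′ → q ℚ.* r ℚ.< q′ ℚ.* r′
*-mono-< {q} {r′ = r′} 0≤q 0≤r q<q′ r<r′ = ℚ.≤-<-trans
  (ℚ.*-monoˡ-≤-nonNeg q {{ℚ.nonNegative 0≤q}} (ℚ.<⇒≤ r<r′))
  (ℚ.*-monoˡ-<-pos r′ {{ℚ.positive (ℚ.≤-<-trans 0≤r r<r′)}} q<q′)

*-nonNeg : ∀ {q r} → 0ℚ ℚ.≤ q → 0ℚ ℚ.≤ r → 0ℚ ℚ.≤ q ℚ.* r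
*-nonNeg {q} {r} 0≤q 0≤r = subst (ℚ._≤ q ℚ.* r) (ℚ.*-zeroʳ q)
  (ℚ.*-monoˡ-≤-nonNeg q {{ℚ.nonNegative 0≤q}} 0≤r)

*-pos : ∀ {q r} → 0ℚ ℚ.< q → 0ℚ ℚ.< r → 0ℚ ℚ.< q ℚ.* r
*-pos {q} {r} 0<q 0<r = subst (ℚ._< q ℚ.* r) (ℚ.*-zeroʳ q)
  (ℚ.*-monoʳ-<-pos q {{ℚ.positive 0<q}} 0<r)

*-pos⁻¹ˡ : ∀ {q r} → 0ℚ ℚ.≤ q → 0ℚ ℚ.< q ℚ.* r → 0ℚ ℚ.< q
*-pos⁻¹ˡ {q} {r} 0≤q 0<qr with ℚ.<-cmp 0ℚ q
... | tri< 0<q _ _ = 0<q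
... | tri≈ _ refl _ = ⊥-elim (ℚ.<-irrefl (sym (ℚ.*-zeroˡ r)) 0<qr)
... | tri> _ _ q<0 = ⊥-elim (≤⇒≯ 0≤q q<0)

*-pos⁻¹ʳ : ∀ {q r} → 0ℚ ℚ.≤ r → 0ℚ ℚ.< q ℚ.* r → 0ℚ ℚ.< r
*-pos⁻¹ʳ {q} {r} 0≤r 0<qr = *-pos⁻¹ˡ {r} {q} 0≤r (subst (0ℚ ℚ.<_) (ℚ.*-comm q r) 0<qr)

reciprocal : ∀ {q} → 0ℚ ℚ.< q → ∃[ r ] 0ℚ ℚ.< r × r ℚ.* q ≡ 1ℚ
reciprocal {q} 0<q = ℚ.1/ q , ℚ.positive⁻¹ _ {{ℚ.1/pos⇒pos q}} , ℚ.*-inverseˡ q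
  where
  instance
    q-pos = ℚ.positive 0<q
    q-nonZero = ℚ.pos⇒nonZero q

-- Take `y` strictly between `x` and `q r`, and `s = y / r`. The cuts of products are made of strict
-- inequalities, so factors must often be shrunk a little without losing `x`.
*-approxˡ : ∀ {x q r} → 0ℚ ℚ.≤ x → 0ℚ ℚ.< r → x ℚ.< q ℚ.* r →
            ∃[ s ] 0ℚ ℚ.< s × s ℚ.< q × x ℚ.< s ℚ.* r
*-approxˡ {x} {q} {r} 0≤x 0<r x<qr =
  let y , x<y , y<qr = ℚ.<-dense x<qr
      u , 0<u , ur≡1 = reciprocal 0<r
      yur≡y = trans (ℚ.*-assoc y u r) (trans (cong (y ℚ.*_) ur≡1) (ℚ.*-identityʳ y))
  in y ℚ.* u , *-pos (ℚ.≤-<-trans 0≤x x<y) 0<u ,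
     ℚ.*-cancelʳ-<-nonNeg r {{ℚ.nonNegative (ℚ.<⇒≤ 0<r)}} (subst (ℚ._< q ℚ.* r) (sym yur≡y) y<qr) ,
     subst (x ℚ.<_) (sym yur≡y) x<y

-- Opaque, since otherwise m and k cannot be inferred.
opaque
  frac : ℕ → ℕ → ℚ
  frac m k = ℤ.+ m ℚ./ suc k

  toℚᵘ-frac : ∀ m k → ℚ.toℚᵘ (frac m k) ℚᵘ.≃ ℚᵘ.mkℚᵘ (ℤ.+ m) k
  toℚᵘ-frac m k = ℚ.toℚᵘ-fromℚᵘ (ℚᵘ.mkℚᵘ (ℤ.+ m) k)

  frac-mono : ∀ {m k n j} → m ℕ.* suc j ℕ.≤ n ℕ.* suc k → frac m k ℚ.≤ frac n j
  frac-mono {m} {k} {n} {j} le = ℚ.toℚᵘ-cancel-≤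
    (ℚᵘ.≤-respˡ-≃ (ℚᵘ.≃-sym (toℚᵘ-frac m k)) (ℚᵘ.≤-respʳ-≃ (ℚᵘ.≃-sym (toℚᵘ-frac n j))
      (ℚᵘ.*≤* (subst₂ ℤ._≤_ (ℤ.pos-* m (suc j)) (ℤ.pos-* n (suc k)) (ℤ.+≤+ le)))))

  frac-cancel : ∀ {m k n j} → frac m k ℚ.≤ frac n j → m ℕ.* suc j ℕ.≤ n ℕ.* suc k
  frac-cancel {m} {k} {n} {j} le with ℚᵘ.≤-respˡ-≃ (toℚᵘ-frac m k) (ℚᵘ.≤-respʳ-≃ (toℚᵘ-frac n j)
      (ℚ.toℚᵘ-mono-≤ le))
  ... | ℚᵘ.*≤* le′ = ℤ.drop‿+≤+ (subst₂ ℤ._≤_ (sym (ℤ.pos-* m (suc j))) (sym (ℤ.pos-* n (suc k))) le′)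

  -- The second argument of `frac` is one less than the denominator, and `j + k (j + 1)` is
  -- `(k + 1)(j + 1) - 1`.
  frac-* : ∀ m k n j → frac m k ℚ.* frac n j ≡ frac (m ℕ.* n) (j ℕ.+ k ℕ.* suc j)
  frac-* m k n j = ℚ.toℚᵘ-injective
    (ℚᵘ.≃-trans (ℚ.toℚᵘ-homo-* (frac m k) (frac n j))
    (ℚᵘ.≃-trans (ℚᵘ.*-cong (toℚᵘ-frac m k) (toℚᵘ-frac n j))
    (ℚᵘ.≃-trans (ℚᵘ.≃-reflexive (cong (λ i → ℚᵘ.mkℚᵘ i (j ℕ.+ k ℕ.* suc j)) (sym (ℤ.pos-* m n))))
      (ℚᵘ.≃-sym (toℚᵘ-frac (m ℕ.* n) (j ℕ.+ k ℕ.* suc j))))))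

  frac-suc : ∀ n → frac (suc n) 0 ≡ frac n 0 ℚ.+ 1ℚ
  frac-suc n = ℚ.toℚᵘ-injective
    (ℚᵘ.≃-trans (toℚᵘ-frac (suc n) 0) (ℚᵘ.≃-sym
    (ℚᵘ.≃-trans (ℚ.toℚᵘ-homo-+ (frac n 0) 1ℚ)
    (ℚᵘ.≃-trans (ℚᵘ.+-congˡ (ℚ.toℚᵘ 1ℚ) (toℚᵘ-frac n 0))
      (ℚᵘ.*≡* (cong (ℤ._* ℤ.1ℤ) (trans (cong (ℤ._+ ℤ.1ℤ) (ℤ.*-identityʳ (ℤ.+ n))) (ℤ.+-comm (ℤ.+ n) ℤ.1ℤ))))))))

  frac-zero : ∀ k → frac 0 k ≡ 0ℚ
  frac-zero k = ℚ.≤-antisym (frac-mono {0} {k} {0} {0} ℕ.z≤n) (frac-mono {0} {0} {0} {k} ℕ.z≤n)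

  frac-one : frac 1 0 ≡ 1ℚ
  frac-one = refl

  frac-nonNeg : ∀ m k → 0ℚ ℚ.≤ frac m k
  frac-nonNeg m k = frac-mono {0} {0} {m} {k} ℕ.z≤n

  frac-inverse : ∀ m k → frac (suc m) k ℚ.* frac (suc k) m ≡ 1ℚ
  frac-inverse m k = trans (frac-* (suc m) k (suc k) m)
    (ℚ.≤-antisym (frac-mono {suc m ℕ.* suc k} {m ℕ.+ k ℕ.* suc m} {1} {0} (ℕ.≤-reflexive eq))
                 (frac-mono {1} {0} {suc m ℕ.* suc k} {m ℕ.+ k ℕ.* suc m} (ℕ.≤-reflexive (sym eq))))
    where
    eq : suc m ℕ.* suc k ℕ.* 1 ≡ 1 ℕ.* (suc k ℕ.* suc m)
    eq = trans (ℕ.*-identityʳ (suc m ℕ.* suc k)) (trans (ℕ.*-comm (suc m) (suc k)) (sym (ℕ.*-identityˡ _)))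

  nonNeg-frac : ∀ {q} → 0ℚ ℚ.≤ q → Σ[ m ∈ ℕ ] Σ[ k ∈ ℕ ] q ≡ frac m k
  nonNeg-frac {q@(mkℚ (ℤ.+ m) k _)} _ = m , k , sym (ℚ.↥p/↧p≡p q)
  nonNeg-frac {mkℚ (ℤ.-[1+ _ ]) _ _} (ℚ.*≤* ())

archimedean : ∀ q → ∃[ n ] q ℚ.≤ frac n 0
archimedean q with q ℚ.≤? 0ℚ
... | yes q≤0 = 0 , ℚ.≤-trans q≤0 (frac-nonNeg 0 0)
... | no q≰0 with nonNeg-frac (ℚ.<⇒≤ (ℚ.≰⇒> q≰0))
-- The numerator bounds the fraction, since the denominator is at least 1.
... | m , k , refl = m , frac-mono {m} {k} {m} {0} (ℕ.*-monoʳ-≤ m (ℕ.s≤s ℕ.z≤n))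

infix 4 _≼_ _≺_ _≋_
infixl 7 _·_
infixl 9 _⁻¹
infixr 8 _↑_ _**_

-- Cuts

-- Opaque copies of the operations, since the original ones unfold to suprema from which
-- their arguments cannot be inferred.
opaque
  _≼_ : [0,∞] → [0,∞] → Set
  _≼_ = _≤_

  _·_ : [0,∞] → [0,∞] → [0,∞]
  _·_ = _⊗_

  _⁻¹ : [0,∞] → [0,∞]
  _⁻¹ = _*

  _**_ : [0,∞] → ℕ → [0,∞]
  _**_ = _^ℕ_

  _↑_ : [0,∞] → [0,∞] → [0,∞]
  _↑_ = _^_

_≺_ _≋_ : [0,∞] → [0,∞] → Set
a ≺ b = ¬ (b ≼ a)
a ≋ b = (a ≼ b) × (b ≼ a)

-- a ^ (m / suc k) ≤ a ^ p
Under : [0,∞] → [0,∞] → ℕ → ℕ → Set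
Under a p m k = (1# ≼ a × ⟨ frac m k ⟩ ≼ p) ⊎ (a ≼ 1# × p ≼ ⟨ frac m k ⟩)

◁-nonNeg : ∀ a b → (∀ q → 0ℚ ℚ.≤ q → q ◁ a → q ◁ b) → a ≤ b
◁-nonNeg a b h q q◁a with 0ℚ ℚ.≤? q
... | yes 0≤q = h q 0≤q q◁a
... | no 0≰q  = [0,∞].negative b (ℚ.≰⇒> 0≰q)

◁-down : ∀ a {q r} → q ℚ.≤ r → r ◁ a → q ◁ a
◁-down a {q} {r} q≤r r◁a with ℚ.<-cmp q r
... | tri< q<r _ _ = [0,∞].down a q<r r◁a
... | tri≈ _ refl _ = r◁a
... | tri> _ _ r<q = ⊥-elim (≤⇒≯ q≤r r<q)

◁⋪⇒< : ∀ a {q r} → q ◁ a → ¬ (r ◁ a) → q ℚ.< r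
◁⋪⇒< a q◁a r⋪a = ℚ.≰⇒> λ r≤q → r⋪a (◁-down a r≤q q◁a)

◁⟨⟩⁺ : ∀ {q r} → q ℚ.< r → q ◁ ⟨ r ⟩
◁⟨⟩⁺ q<r = inj₂ (_ , q<r , refl)

◁⟨⟩⁻ : ∀ {q r} → 0ℚ ℚ.≤ q → q ◁ ⟨ r ⟩ → q ℚ.< r
◁⟨⟩⁻ 0≤q (inj₁ q<0) = ⊥-elim (≤⇒≯ 0≤q q<0)
◁⟨⟩⁻ _   (inj₂ (_ , q<r , refl)) = q<r

◁⊗⁺ : ∀ a b {q r} → 0ℚ ℚ.≤ q → q ◁ a → 0ℚ ℚ.≤ r → r ◁ b → q ℚ.* r ◁ a ⊗ b
◁⊗⁺ a b 0≤q q◁a 0≤r r◁b =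
  -- The supremum defining `_⊗_` asks for a strictly larger product, so both factors are first
  -- enlarged inside their cuts.
  let q′ , q<q′ , q′◁a = [0,∞].open′ a q◁a
      r′ , r<r′ , r′◁b = [0,∞].open′ b r◁b
  in inj₂ (q′ ℚ.* r′ , *-mono-< 0≤q 0≤r q<q′ r<r′ ,
           q′ , r′ , (ℚ.<⇒≤ (ℚ.≤-<-trans 0≤q q<q′) , q′◁a) , (ℚ.<⇒≤ (ℚ.≤-<-trans 0≤r r<r′) , r′◁b) , refl)

record Factors (a b : [0,∞]) (x : ℚ) : Set where
  constructor factors
  field
    {q r} : ℚ
    0≤q   : 0ℚ ℚ.≤ q
    q◁a   : q ◁ a
    0≤r   : 0ℚ ℚ.≤ r
    r◁b   : r ◁ b
    x<qr  : x ℚ.< q ℚ.* r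

◁⊗⁻ : ∀ a b {x} → 0ℚ ℚ.≤ x → x ◁ a ⊗ b → Factors a b x
◁⊗⁻ a b 0≤x (inj₁ x<0) = ⊥-elim (≤⇒≯ 0≤x x<0)
◁⊗⁻ a b 0≤x (inj₂ (_ , x<qr , _ , _ , (0≤q , q◁a) , (0≤r , r◁b) , refl)) = factors 0≤q q◁a 0≤r r◁b x<qr

opaque
  unfolding _≼_

  ≼-refl : ∀ {a} → a ≼ a
  ≼-refl q h = h

  ≼-trans : ∀ {a b c} → a ≼ b → b ≼ c → a ≼ c
  ≼-trans a≼b b≼c q h = b≼c q (a≼b q h)

  0≼ : ∀ {a} → 0# ≼ a
  0≼ {a} = ◁-nonNeg 0# a λ q 0≤q q◁0 → ⊥-elim (≤⇒≯ 0≤q (◁⟨⟩⁻ 0≤q q◁0))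

  ≼∞ : ∀ {a} → a ≼ ∞#
  ≼∞ q _ = inj₂ (q ℚ.+ 1ℚ , subst (ℚ._< q ℚ.+ 1ℚ) (ℚ.+-identityʳ q) (ℚ.+-monoʳ-< q (ℚ.positive⁻¹ 1ℚ)) , tt)

  ⟨⟩-mono : ∀ {q r} → q ℚ.≤ r → ⟨ q ⟩ ≼ ⟨ r ⟩
  ⟨⟩-mono {q} {r} q≤r = ◁-nonNeg ⟨ q ⟩ ⟨ r ⟩ λ x 0≤x h → ◁⟨⟩⁺ (ℚ.<-≤-trans (◁⟨⟩⁻ 0≤x h) q≤r)

  ⟨⟩-cancel : ∀ {q r} → 0ℚ ℚ.≤ r → ⟨ q ⟩ ≼ ⟨ r ⟩ → q ℚ.≤ r
  ⟨⟩-cancel {q} {r} 0≤r h = ℚ.≮⇒≥ λ r<q → ℚ.<-irrefl refl (◁⟨⟩⁻ 0≤r (h r (◁⟨⟩⁺ r<q)))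

  ◁⇒≺ : ∀ {q} a → 0ℚ ℚ.≤ q → q ◁ a → ⟨ q ⟩ ≺ a
  ◁⇒≺ {q} _ 0≤q q◁a a≤q = ℚ.<-irrefl refl (◁⟨⟩⁻ 0≤q (a≤q q q◁a))

  ⋪⇒≼ : ∀ {q} a → ¬ (q ◁ a) → a ≼ ⟨ q ⟩
  ⋪⇒≼ a q⋪a r r◁a = ◁⟨⟩⁺ (◁⋪⇒< a r◁a q⋪a)

  ·-mono : ∀ {a b c d} → a ≼ b → c ≼ d → a · c ≼ b · d
  ·-mono {a} {b} {c} {d} a≼b c≼d x (inj₁ x<0) = inj₁ x<0
  ·-mono {a} {b} {c} {d} a≼b c≼d x (inj₂ (_ , x<qr , q , r , (0≤q , q◁a) , (0≤r , r◁c) , eq)) =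
    inj₂ (_ , x<qr , q , r , (0≤q , a≼b q q◁a) , (0≤r , c≼d r r◁c) , eq)

  ⁻¹-anti : ∀ {a b} → a ≼ b → b ⁻¹ ≼ a ⁻¹
  ⁻¹-anti a≼b x (inj₁ x<0) = inj₁ x<0
  ⁻¹-anti a≼b x (inj₂ (r , x<r , s , 0<s , s⋪b , eq)) = inj₂ (r , x<r , s , 0<s , s⋪b ∘ a≼b s , eq)

  0⁻¹ : 0# ⁻¹ ≋ ∞#
  0⁻¹ = 0*

  ∞⁻¹ : ∞# ⁻¹ ≋ 0#
  ∞⁻¹ = ∞*

  ·-comm-≼ : ∀ a b → a · b ≼ b · a
  ·-comm-≼ a b x (inj₁ x<0) = inj₁ x<0
  ·-comm-≼ a b x (inj₂ (_ , x<qr , q , r , h , h′ , refl)) = inj₂ (_ , x<qr , r , q , h′ , h , ℚ.*-comm q r)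

  ·-assoc-≼ : ∀ a b c → (a · b) · c ≼ a · (b · c)
  ·-assoc-≼ a b c = ◁-nonNeg ((a ⊗ b) ⊗ c) (a ⊗ (b ⊗ c)) λ x 0≤x h →
    let factors {s} {t} 0≤s s◁ab 0≤t t◁c x<st = ◁⊗⁻ (a ⊗ b) c 0≤x h
        factors {q} {r} 0≤q q◁a 0≤r r◁b s<qr = ◁⊗⁻ a b 0≤s s◁ab
    in [0,∞].down (a ⊗ (b ⊗ c)) x<st (◁-down (a ⊗ (b ⊗ c))
      (ℚ.≤-trans (ℚ.*-monoʳ-≤-nonNeg t {{ℚ.nonNegative 0≤t}} (ℚ.<⇒≤ s<qr)) (ℚ.≤-reflexive (ℚ.*-assoc q r t)))
      (◁⊗⁺ a (b ⊗ c) 0≤q q◁a (*-nonNeg 0≤r 0≤t) (◁⊗⁺ b c 0≤r r◁b 0≤t t◁c)))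

  ·-zeroˡ-≼ : ∀ a → 0# · a ≼ 0#
  ·-zeroˡ-≼ a = ◁-nonNeg (0# ⊗ a) 0# λ x 0≤x h →
    let factors 0≤q q◁0 _ _ _ = ◁⊗⁻ 0# a 0≤x h in ⊥-elim (≤⇒≯ 0≤q (◁⟨⟩⁻ 0≤q q◁0))

  ⟨⟩-·-≼ : ∀ {q r} → ⟨ q ⟩ · ⟨ r ⟩ ≼ ⟨ q ℚ.* r ⟩
  ⟨⟩-·-≼ {q} {r} = ◁-nonNeg (⟨ q ⟩ ⊗ ⟨ r ⟩) ⟨ q ℚ.* r ⟩ λ x 0≤x h →
    let factors 0≤s s◁q 0≤t t◁r x<st = ◁⊗⁻ ⟨ q ⟩ ⟨ r ⟩ 0≤x h
        s<q = ◁⟨⟩⁻ 0≤s s◁q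
        t<r = ◁⟨⟩⁻ 0≤t t◁r
    in ◁⟨⟩⁺ (ℚ.<-trans x<st (*-mono-< 0≤s 0≤t s<q t<r))

  ⟨⟩-·-≽ : ∀ {q r} → 0ℚ ℚ.≤ q → 0ℚ ℚ.≤ r → ⟨ q ℚ.* r ⟩ ≼ ⟨ q ⟩ · ⟨ r ⟩
  ⟨⟩-·-≽ {q} {r} 0≤q 0≤r = ◁-nonNeg ⟨ q ℚ.* r ⟩ (⟨ q ⟩ ⊗ ⟨ r ⟩) λ x 0≤x h →
    let x<qr = ◁⟨⟩⁻ 0≤x h
        -- Both factors must drop strictly below `q` and `r`. The second is shrunk against the first
        -- one already shrunk, so that the product stays above `x` throughout.
        s , 0<s , s<q , x<sr = *-approxˡ 0≤x (*-pos⁻¹ʳ {q} 0≤r (ℚ.≤-<-trans 0≤x x<qr)) x<qr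
        t , 0<t , t<r , x<ts = *-approxˡ 0≤x 0<s (subst (x ℚ.<_) (ℚ.*-comm s r) x<sr)
    in inj₂ (s ℚ.* t , subst (x ℚ.<_) (ℚ.*-comm t s) x<ts , s , t ,
             (ℚ.<⇒≤ 0<s , ◁⟨⟩⁺ s<q) , (ℚ.<⇒≤ 0<t , ◁⟨⟩⁺ t<r) , refl)

  ·-identityˡ-≼ : ∀ a → 1# · a ≼ a
  ·-identityˡ-≼ a = ◁-nonNeg (1# ⊗ a) a λ x 0≤x h →
    let factors {s} {t} 0≤s s◁1 0≤t t◁a x<st = ◁⊗⁻ 1# a 0≤x h
    in ◁-down a (ℚ.≤-trans (ℚ.<⇒≤ x<st) (ℚ.≤-trans
      (ℚ.*-monoʳ-≤-nonNeg t {{ℚ.nonNegative 0≤t}} (ℚ.<⇒≤ (◁⟨⟩⁻ 0≤s s◁1)))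
      (ℚ.≤-reflexive (ℚ.*-identityˡ t)))) t◁a

  ·-identityˡ-≽ : ∀ a → a ≼ 1# · a
  ·-identityˡ-≽ a = ◁-nonNeg a (1# ⊗ a) λ x 0≤x x◁a →
    let y , x<y , y◁a = [0,∞].open′ a x◁a
        0<y = ℚ.≤-<-trans 0≤x x<y
        s , 0<s , s<1 , x<sy = *-approxˡ 0≤x 0<y (subst (x ℚ.<_) (sym (ℚ.*-identityˡ y)) x<y)
    in inj₂ (s ℚ.* y , x<sy , s , y , (ℚ.<⇒≤ 0<s , ◁⟨⟩⁺ s<1) , (ℚ.<⇒≤ 0<y , y◁a) , refl)

  -- If `q < a ≤ s` and `r < 1/s`, then `q r ≤ s · (1/s) = 1`.
  ·-inverseʳ-≼ : ∀ a → a · a ⁻¹ ≼ 1#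
  ·-inverseʳ-≼ a = ◁-nonNeg (a ⊗ a *) 1# λ x 0≤x h → ◁⟨⟩⁺ (bound (◁⊗⁻ a (a *) 0≤x h))
    where
    bound : ∀ {x} → Factors a (a *) x → x ℚ.< 1ℚ
    bound (factors _ _ 0≤r (inj₁ r<0) _) = ⊥-elim (≤⇒≯ 0≤r r<0)
    bound (factors {q} {r} 0≤q q◁a 0≤r (inj₂ (t , r<t , s , 0<s , s⋪a , ts≡1)) x<qr) =
      ℚ.<-≤-trans x<qr (ℚ.≤-trans
        (*-mono-≤ 0≤q (ℚ.≤-trans 0≤r (ℚ.<⇒≤ r<t)) (ℚ.<⇒≤ (◁⋪⇒< a q◁a s⋪a)) (ℚ.<⇒≤ r<t))
        (ℚ.≤-reflexive (trans (ℚ.*-comm s t) ts≡1)))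

  -- Membership in the cut of `a · b` uses a single rational `q` from the cut of `a`. Openness gives
  -- `q′` in that cut with `q < q′`, and `⟨ q′ ⟩` serves as `c`.
  ·-leftContinuous : ∀ {a b d} → (∀ c → c ≺ a → c · b ≼ d) → a · b ≼ d
  ·-leftContinuous {a} {b} {d} h = ◁-nonNeg (a ⊗ b) d λ x 0≤x x◁ab →
    let factors {q} {r} 0≤q q◁a 0≤r r◁b x<qr = ◁⊗⁻ a b 0≤x x◁ab
        q′ , q<q′ , q′◁a = [0,∞].open′ a q◁a
        0≤q′ = ℚ.<⇒≤ (ℚ.≤-<-trans 0≤q q<q′)
    in h ⟨ q′ ⟩ (◁⇒≺ a 0≤q′ q′◁a) x (inj₂ (q ℚ.* r , x<qr , q , r , (0≤q , ◁⟨⟩⁺ q<q′) , (0≤r , r◁b) , refl))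

  ⊕-mono : ∀ {a b c d} → a ≼ b → c ≼ d → a ⊕ c ≼ b ⊕ d
  ⊕-mono a≼b c≼d x (inj₁ x<0) = inj₁ x<0
  ⊕-mono a≼b c≼d x (inj₂ (r , x<r , s , t , s◁a , t◁c , eq)) =
    inj₂ (r , x<r , s , t , a≼b s s◁a , c≼d t t◁c , eq)

  0⊕0≼0 : 0# ⊕ 0# ≼ 0#
  0⊕0≼0 x (inj₁ x<0) = inj₁ x<0
  0⊕0≼0 x (inj₂ (_ , x<st , s , t , s◁0 , t◁0 , refl)) = inj₁ (ℚ.<-trans x<st (ℚ.+-mono-< (neg s◁0) (neg t◁0)))
    where
    neg : ∀ {s} → s ◁ 0# → s ℚ.< 0ℚ
    neg (inj₁ s<0) = s<0
    neg (inj₂ (_ , s<0 , refl)) = s<0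

  -- The cut of `b` need not contain 0, but it contains all negative rationals. With `x < m < y` and
  -- `y` in the cut of `a`, the sum `y + (m - y) = m` exceeds `x`.
  ≼⊕ˡ : ∀ a b → a ≼ a ⊕ b
  ≼⊕ˡ a b x x◁a =
    let y , x<y , y◁a = [0,∞].open′ a x◁a
        m , x<m , m<y = ℚ.<-dense x<y
        y+[m-y]≡m = trans (ℚ.+-comm y (m ℚ.- y)) (trans (ℚ.+-assoc m (ℚ.- y) y)
          (trans (cong (m ℚ.+_) (ℚ.+-inverseˡ y)) (ℚ.+-identityʳ m)))
    in inj₂ (y ℚ.+ (m ℚ.- y) , subst (x ℚ.<_) (sym y+[m-y]≡m) x<m , y , m ℚ.- y , y◁a ,
             [0,∞].negative b (subst (m ℚ.- y ℚ.<_) (ℚ.+-inverseʳ y) (ℚ.+-monoˡ-< (ℚ.- y) m<y)) , refl)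

  ≼⊕ʳ : ∀ a b → b ≼ a ⊕ b
  ≼⊕ʳ a b x x◁b with ≼⊕ˡ b a x x◁b
  ... | inj₁ x<0 = inj₁ x<0
  ... | inj₂ (_ , x<st , s , t , s◁b , t◁a , refl) = inj₂ (_ , x<st , t , s , t◁a , s◁b , ℚ.+-comm s t)

  ⟨⟩-distrib-⊕ : ∀ q a b → ⟨ q ⟩ · (a ⊕ b) ≼ ⟨ q ⟩ · a ⊕ ⟨ q ⟩ · b
  ⟨⟩-distrib-⊕ q a b = ◁-nonNeg (⟨ q ⟩ ⊗ (a ⊕ b)) (⟨ q ⟩ ⊗ a ⊕ ⟨ q ⟩ ⊗ b) λ x 0≤x h → go 0≤x (◁⊗⁻ ⟨ q ⟩ (a ⊕ b) 0≤x h)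
    where
    -- Summands in the cut of a sum may be negative, factors in the cut of a product may not. For
    -- negative `v` the product `s v` is negative and lies in every cut.
    scale : ∀ c {s v} → 0ℚ ℚ.< s → s ◁ ⟨ q ⟩ → v ◁ c → s ℚ.* v ◁ ⟨ q ⟩ ⊗ c
    scale c {s} {v} 0<s s◁q v◁c with 0ℚ ℚ.≤? v
    ... | yes 0≤v = ◁⊗⁺ ⟨ q ⟩ c (ℚ.<⇒≤ 0<s) s◁q 0≤v v◁c
    ... | no 0≰v  = inj₁ (subst (s ℚ.* v ℚ.<_) (ℚ.*-zeroʳ s)
      (ℚ.*-monoʳ-<-pos s {{ℚ.positive 0<s}} (ℚ.≰⇒> 0≰v)))
    go : ∀ {x} → 0ℚ ℚ.≤ x → Factors ⟨ q ⟩ (a ⊕ b) x → x ◁ ⟨ q ⟩ ⊗ a ⊕ ⟨ q ⟩ ⊗ b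
    go 0≤x (factors _ _ 0≤u (inj₁ u<0) _) = ⊥-elim (≤⇒≯ 0≤u u<0)
    go 0≤x (factors {s} {u} 0≤s s◁q 0≤u (inj₂ (_ , u<vw , v , w , v◁a , w◁b , refl)) x<su) =
      let 0<s = *-pos⁻¹ˡ {s} {u} 0≤s (ℚ.≤-<-trans 0≤x x<su)
      in inj₂ (s ℚ.* v ℚ.+ s ℚ.* w ,
           subst (_ ℚ.<_) (ℚ.*-distribˡ-+ s v w) (ℚ.<-trans x<su (ℚ.*-monoʳ-<-pos s {{ℚ.positive 0<s}} u<vw)) ,
           s ℚ.* v , s ℚ.* w , scale a 0<s s◁q v◁a , scale b 0<s s◁q w◁b , refl)

  ≼⋁ : ∀ {I : Set} (a : I → [0,∞]) i → a i ≼ ⋁ a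
  ≼⋁ a i x x◁ai = let y , x<y , y◁ai = [0,∞].open′ (a i) x◁ai in inj₂ (y , x<y , i , y◁ai)

  ⋁≼ : ∀ {I : Set} (a : I → [0,∞]) {d} → (∀ i → a i ≼ d) → ⋁ a ≼ d
  ⋁≼ a {d} h x (inj₁ x<0) = [0,∞].negative d x<0
  ⋁≼ a {d} h x (inj₂ (y , x<y , i , y◁ai)) = [0,∞].down d x<y (h i y y◁ai)

  ⋀≼ : ∀ {I : Set} (a : I → [0,∞]) i → ⋀ a ≼ a i
  ⋀≼ a i x (inj₁ x<0) = [0,∞].negative (a i) x<0
  ⋀≼ a i x (inj₂ (y , x<y , h)) = [0,∞].down (a i) x<y (h i)

  ≼⋀ : ∀ {I : Set} (a : I → [0,∞]) {d} → (∀ i → d ≼ a i) → d ≼ ⋀ a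
  ≼⋀ a {d} h x x◁d = let y , x<y , y◁d = [0,∞].open′ d x◁d in inj₂ (y , x<y , λ i → h i y y◁d)

  **-zero : ∀ a → a ** 0 ≡ 1#
  **-zero a = refl

  **-suc : ∀ a n → a ** suc n ≡ a · a ** n
  **-suc a n = refl

opaque
  unfolding _≼_ frac

  ≼↑ : ∀ {a p q} m k → 0ℚ ℚ.≤ q → Under a p m k →
            ⟨ q ⟩ ** suc k ≼ a ** m → ⟨ q ⟩ ≼ a ↑ p
  ≼↑ {a} {p} {q} m k 0≤q c h x (inj₁ x<0) = inj₁ x<0
  ≼↑ {a} {p} {q} m k 0≤q c h x (inj₂ (_ , x<q , refl)) = inj₂ (q , x<q , 0≤q , m , k , c , h)

  ↑≼ : ∀ {a p d} →
            (∀ q m k → 0ℚ ℚ.≤ q → Under a p m k →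
              ⟨ q ⟩ ** suc k ≼ a ** m → ⟨ q ⟩ ≼ d) → a ↑ p ≼ d
  ↑≼ {d = d} h x (inj₁ x<0) = [0,∞].negative d x<0
  ↑≼ {d = d} h x (inj₂ (q , x<q , 0≤q , m , k , c , le)) = h q m k 0≤q c le x (◁⟨⟩⁺ x<q)

-- Separation of cuts by rationals, and the inverse

module Separation (lem : ExcludedMiddle 0ℓ) where

  ¬¬-elim : ∀ {P : Set} → ¬ ¬ P → P
  ¬¬-elim {P} ¬¬p with lem {P}
  ... | yes p = p
  ... | no ¬p = ⊥-elim (¬¬p ¬p)

  opaque
    unfolding _≼_

    separate : ∀ a b → a ≺ b → ∃[ q ] 0ℚ ℚ.≤ q × ¬ (q ◁ a) × q ◁ b
    separate a b b≰a = ¬¬-elim λ none → b≰a (◁-nonNeg b a λ q 0≤q q◁b →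
      ¬¬-elim λ q⋪a → none (q , 0≤q , q⋪a , q◁b))

    ≺-rational : ∀ {a b} → a ≺ b → ∃[ q ] 0ℚ ℚ.≤ q × a ≼ ⟨ q ⟩ × ⟨ q ⟩ ≺ b
    ≺-rational {a} {b} a≺b =
      let q , 0≤q , q⋪a , q◁b = separate a b a≺b in q , 0≤q , ⋪⇒≼ a q⋪a , ◁⇒≺ b 0≤q q◁b

    ≺-dense : ∀ {a b} → a ≺ b → ∃[ q ] 0ℚ ℚ.< q × a ≺ ⟨ q ⟩ × ⟨ q ⟩ ≺ b
    ≺-dense {a} {b} a≺b =
      let q , 0≤q , q⋪a , q◁b = separate a b a≺b
          r , q<r , r◁b = [0,∞].open′ b q◁b
          0<r = ℚ.≤-<-trans 0≤q q<r
      in r , 0<r , (λ r≤a → q⋪a (r≤a q (◁⟨⟩⁺ q<r))) , ◁⇒≺ b (ℚ.<⇒≤ 0<r) r◁b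

    ≺⇒≼ : ∀ {a b} → a ≺ b → a ≼ b
    ≺⇒≼ {a} {b} a≺b x x◁a =
      let q , 0≤q , q⋪a , q◁b = separate a b a≺b in [0,∞].down b (◁⋪⇒< a x◁a q⋪a) q◁b

  -- Used to step a progression out of a cut, to trap `p` between consecutive fractions, and to make
  -- a union disjoint. The search runs down from `n`, so it finds the last `k` below `n` satisfying
  -- `P`.
  first-failure : ∀ (P : ℕ → Set) n → P 0 → ¬ P n → ∃[ k ] P k × ¬ P (suc k)
  first-failure P zero    p0 ¬pn = ⊥-elim (¬pn p0)
  first-failure P (suc n) p0 ¬pn with lem {P n}
  ... | yes pn = n , pn , ¬pn
  ... | no ¬p  = first-failure P n p0 ¬p

  -- Some step of the progression s + kε with ε = s (1 - q) leaves the cut, and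
  -- the terms on either side of it have ratio greater than q.
  cut-ratio : ∀ a {s q} → 0ℚ ℚ.< s → s ◁ a → (∃[ t ] ¬ (t ◁ a)) → 0ℚ ℚ.≤ q → q ℚ.< 1ℚ →
              ∃[ u ] ∃[ v ] 0ℚ ℚ.< v × u ◁ a × ¬ (v ◁ a) × q ℚ.* v ℚ.< u
  cut-ratio a {s} {q} 0<s s◁a (t , t⋪a) 0≤q q<1 =
    u k , u (suc k) , 0<u (suc k) , uk◁a , usk⋪a , qu<u
    where
    instance
      q-nonNeg = ℚ.nonNegative 0≤q
    0<1-q : 0ℚ ℚ.< 1ℚ ℚ.- q
    0<1-q = subst (ℚ._< 1ℚ ℚ.- q) (ℚ.+-inverseʳ q) (ℚ.+-monoˡ-< (ℚ.- q) q<1)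
    ε = s ℚ.* (1ℚ ℚ.- q)
    0<ε : 0ℚ ℚ.< ε
    0<ε = *-pos 0<s 0<1-q
    u : ℕ → ℚ
    u k = s ℚ.+ frac k 0 ℚ.* ε
    s≤u : ∀ k → s ℚ.≤ u k
    s≤u k = subst (ℚ._≤ u k) (ℚ.+-identityʳ s) (ℚ.+-monoʳ-≤ s (*-nonNeg (frac-nonNeg k 0) (ℚ.<⇒≤ 0<ε)))
    0<u : ∀ k → 0ℚ ℚ.< u k
    0<u k = ℚ.<-≤-trans 0<s (s≤u k)
    u-suc : ∀ k → u (suc k) ≡ u k ℚ.+ ε
    u-suc k = trans (cong (λ x → s ℚ.+ x ℚ.* ε) (frac-suc k))
      (trans (cong (s ℚ.+_) (trans (ℚ.*-distribʳ-+ ε (frac k 0) 1ℚ) (cong (frac k 0 ℚ.* ε ℚ.+_) (ℚ.*-identityˡ ε))))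
        (sym (ℚ.+-assoc s (frac k 0 ℚ.* ε) ε)))
    escape : ∃[ n ] ¬ (u n ◁ a)
    escape =
      let r , 0<r , rε≡1 = reciprocal 0<ε
          n , tr≤n = archimedean (t ℚ.* r)
          t≤nε = subst (ℚ._≤ frac n 0 ℚ.* ε)
            (trans (ℚ.*-assoc t r ε) (trans (cong (t ℚ.*_) rε≡1) (ℚ.*-identityʳ t)))
            (ℚ.*-monoʳ-≤-nonNeg ε {{ℚ.nonNegative (ℚ.<⇒≤ 0<ε)}} tr≤n)
          nε≤u = subst (ℚ._≤ u n) (ℚ.+-identityˡ (frac n 0 ℚ.* ε)) (ℚ.+-monoˡ-≤ (frac n 0 ℚ.* ε) (ℚ.<⇒≤ 0<s))
      in n , λ un◁a → t⋪a (◁-down a (ℚ.≤-trans t≤nε nε≤u) un◁a)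
    step = first-failure (λ k → u k ◁ a) (proj₁ escape)
      (subst (_◁ a) (sym (trans (cong (λ x → s ℚ.+ x ℚ.* ε) (frac-zero 0)) (trans (cong (s ℚ.+_) (ℚ.*-zeroˡ ε)) (ℚ.+-identityʳ s)))) s◁a) (proj₂ escape)
    k = proj₁ step
    uk◁a = proj₁ (proj₂ step)
    usk⋪a = proj₂ (proj₂ step)
    split : ∀ x → q ℚ.* x ℚ.+ x ℚ.* (1ℚ ℚ.- q) ≡ x
    split x = trans (cong (ℚ._+ x ℚ.* (1ℚ ℚ.- q)) (ℚ.*-comm q x))
      (trans (sym (ℚ.*-distribˡ-+ x q (1ℚ ℚ.- q)))
        (trans (cong (x ℚ.*_) (trans (ℚ.+-comm q (1ℚ ℚ.- q)) (trans (ℚ.+-assoc 1ℚ (ℚ.- q) q)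
          (trans (cong (1ℚ ℚ.+_) (ℚ.+-inverseˡ q)) (ℚ.+-identityʳ 1ℚ))))) (ℚ.*-identityʳ x)))
    qε<ε : q ℚ.* ε ℚ.< ε
    qε<ε = subst (q ℚ.* ε ℚ.<_) (ℚ.*-identityˡ ε) (ℚ.*-monoˡ-<-pos ε {{ℚ.positive 0<ε}} q<1)
    qu<u : q ℚ.* u (suc k) ℚ.< u k
    qu<u = begin-strict
      q ℚ.* u (suc k)                       ≡⟨ cong (q ℚ.*_) (u-suc k) ⟩
      q ℚ.* (u k ℚ.+ ε)                     ≡⟨ ℚ.*-distribˡ-+ q (u k) ε ⟩
      q ℚ.* u k ℚ.+ q ℚ.* ε                 <⟨ ℚ.+-monoʳ-< (q ℚ.* u k) qε<ε ⟩
      q ℚ.* u k ℚ.+ s ℚ.* (1ℚ ℚ.- q)        ≤⟨ ℚ.+-monoʳ-≤ (q ℚ.* u k)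
        (ℚ.*-monoʳ-≤-nonNeg (1ℚ ℚ.- q) {{ℚ.nonNegative (ℚ.<⇒≤ 0<1-q)}} (s≤u k)) ⟩
      q ℚ.* u k ℚ.+ u k ℚ.* (1ℚ ℚ.- q)      ≡⟨ split (u k) ⟩
      u k                                   ∎
      where open ℚ.≤-Reasoning

  opaque
    unfolding _≼_

    -- For `q < 1`, `cut-ratio` yields `u` inside the cut and `v` outside it with `q v < u`, so
    -- `q < u · (1/v)`. Here `1/v` is one of the rationals defining `a *`; it is then shrunk
    -- slightly to lie strictly inside that cut. The hypotheses supply a positive point of the cut
    -- to start from and a point outside it.
    ·-inverseʳ-≽ : ∀ {a} → 0# ≺ a → a ≺ ∞# → 1# ≼ a · a ⁻¹
    ·-inverseʳ-≽ {a} 0≺a a≺∞ = ◁-nonNeg 1# (a ⊗ a *) λ q 0≤q q◁1 →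
      let s₀ , 0≤s₀ , _ , s₀◁a = separate 0# a 0≺a
          s , s₀<s , s◁a = [0,∞].open′ a s₀◁a
          t , _ , t⋪a , _ = separate a ∞# a≺∞
          u , v , 0<v , u◁a , v⋪a , qv<u =
            cut-ratio a (ℚ.≤-<-trans 0≤s₀ s₀<s) s◁a (t , t⋪a) 0≤q (◁⟨⟩⁻ 0≤q q◁1)
          w , 0<w , wv≡1 = reciprocal 0<v
          qvw≡q = trans (ℚ.*-assoc q v w) (trans (cong (q ℚ.*_) (trans (ℚ.*-comm v w) wv≡1)) (ℚ.*-identityʳ q))
          0<u = ℚ.≤-<-trans (*-nonNeg 0≤q (ℚ.<⇒≤ 0<v)) qv<u
          q<wu = subst₂ ℚ._<_ qvw≡q (ℚ.*-comm u w) (ℚ.*-monoˡ-<-pos w {{ℚ.positive 0<w}} qv<u)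
          r , 0<r , r<w , q<ru = *-approxˡ 0≤q 0<u q<wu
      in inj₂ (u ℚ.* r , subst (q ℚ.<_) (ℚ.*-comm r u) q<ru , u , r ,
               (ℚ.<⇒≤ 0<u , u◁a) , (ℚ.<⇒≤ 0<r , inj₂ (w , r<w , v , 0<v , v⋪a , wv≡1)) , refl)

≋-refl : ∀ {a} → a ≋ a
≋-refl = ≼-refl , ≼-refl

≋-sym : ∀ {a b} → a ≋ b → b ≋ a
≋-sym = swap

≋-trans : ∀ {a b c} → a ≋ b → b ≋ c → a ≋ c
≋-trans (a≼b , b≼a) (b≼c , c≼b) = ≼-trans a≼b b≼c , ≼-trans c≼b b≼a

≼-poset : Poset _ _ _
≼-poset = record
  { _≈_ = _≋_
  ; _≤_ = _≼_
  ; isPartialOrder = record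
    { isPreorder = record
      { isEquivalence = record { refl = ≋-refl ; sym = ≋-sym ; trans = ≋-trans }
      ; reflexive     = proj₁
      ; trans         = ≼-trans
      }
    ; antisym = _,_
    }
  }

open PartialOrderReasoning ≼-poset

·-cong : ∀ {a b c d} → a ≋ b → c ≋ d → a · c ≋ b · d
·-cong (a≼b , b≼a) (c≼d , d≼c) = ·-mono a≼b c≼d , ·-mono b≼a d≼c

⁻¹-cong : ∀ {a b} → a ≋ b → a ⁻¹ ≋ b ⁻¹
⁻¹-cong (a≼b , b≼a) = ⁻¹-anti b≼a , ⁻¹-anti a≼b

·-comm : ∀ a b → a · b ≋ b · a
·-comm a b = ·-comm-≼ a b , ·-comm-≼ b a

·-assoc : ∀ a b c → (a · b) · c ≋ a · (b · c)
-- The reverse inequality is the first one used twice under cyclic rotation of `a`, `b`, `c`.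
·-assoc a b c = ·-assoc-≼ a b c , (begin
  a · (b · c) ≈⟨ ·-comm a (b · c) ⟩
  (b · c) · a ≤⟨ ·-assoc-≼ b c a ⟩
  b · (c · a) ≈⟨ ·-comm b (c · a) ⟩
  (c · a) · b ≤⟨ ·-assoc-≼ c a b ⟩
  c · (a · b) ≈⟨ ·-comm c (a · b) ⟩
  (a · b) · c ∎)

·-identityˡ : ∀ a → 1# · a ≋ a
·-identityˡ a = ·-identityˡ-≼ a , ·-identityˡ-≽ a

·-identityʳ : ∀ a → a · 1# ≋ a
·-identityʳ a = ≋-trans (·-comm a 1#) (·-identityˡ a)

·-commutativeMonoid : CommutativeMonoid _ _
·-commutativeMonoid = record
  { _≈_ = _≋_
  ; _∙_ = _·_
  ; ε   = 1#
  ; isCommutativeMonoid = record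
    { isMonoid = record
      { isSemigroup = record
        { isMagma = record
          { isEquivalence = record { refl = ≋-refl ; sym = ≋-sym ; trans = ≋-trans }
          ; ∙-cong        = ·-cong
          }
        ; assoc = ·-assoc
        }
      ; identity = ·-identityˡ , ·-identityʳ
      }
    ; comm = ·-comm
    }
  }

open CommutativeSemigroupProperties (CommutativeMonoid.commutativeSemigroup ·-commutativeMonoid)
  using (x∙yz≈y∙xz)

·-zeroˡ : ∀ a → 0# · a ≋ 0#
·-zeroˡ a = ·-zeroˡ-≼ a , 0≼

·-zeroʳ : ∀ a → a · 0# ≋ 0#
·-zeroʳ a = ≋-trans (·-comm a 0#) (·-zeroˡ a)

·-monoˡ : ∀ {a b c} → a ≼ b → a · c ≼ b · c
·-monoˡ a≼b = ·-mono a≼b ≼-refl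

·-monoʳ : ∀ {a b c} → a ≼ b → c · a ≼ c · b
·-monoʳ a≼b = ·-mono ≼-refl a≼b

·-congˡ : ∀ {a b c} → a ≋ b → c · a ≋ c · b
·-congˡ = ·-cong ≋-refl

·-congʳ : ∀ {a b c} → a ≋ b → a · c ≋ b · c
·-congʳ a≋b = ·-cong a≋b ≋-refl

≼-≺-trans : ∀ {a b c} → a ≼ b → b ≺ c → a ≺ c
≼-≺-trans a≼b b≺c c≼a = b≺c (≼-trans c≼a a≼b)

≺-≼-trans : ∀ {a b c} → a ≺ b → b ≼ c → a ≺ c
≺-≼-trans a≺b b≼c c≼a = a≺b (≼-trans b≼c c≼a)

-- Natural powers

module _ where
  open Mult ·-commutativeMonoid renaming (_×_ to _×·_)

  -- Natural powers are the multiples of the commutative monoid written multiplicatively, so the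
  -- laws of multiples carry over.
  **≋× : ∀ a n → a ** n ≋ n ×· a
  **≋× a zero    rewrite **-zero a  = ≋-refl
  **≋× a (suc n) rewrite **-suc a n = ·-congˡ (**≋× a n)

  **-* : ∀ a m n → (a ** m) ** n ≋ a ** (m ℕ.* n)
  **-* a m n = begin-equality
    (a ** m) ** n      ≈⟨ **≋× (a ** m) n ⟩
    n ×· (a ** m)      ≈⟨ ×-congʳ n (**≋× a m) ⟩
    n ×· (m ×· a)      ≈⟨ ×-assocˡ a n m ⟩
    (n ℕ.* m) ×· a     ≡⟨ cong (_×· a) (ℕ.*-comm n m) ⟩
    (m ℕ.* n) ×· a     ≈⟨ **≋× a (m ℕ.* n) ⟨
    a ** (m ℕ.* n)     ∎

  **-distrib-· : ∀ a b n → (a · b) ** n ≋ a ** n · b ** n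
  **-distrib-· a b n = begin-equality
    (a · b) ** n      ≈⟨ **≋× (a · b) n ⟩
    n ×· (a · b)      ≈⟨ ×-distrib-+ a b n ⟩
    n ×· a · n ×· b   ≈⟨ ·-cong (**≋× a n) (**≋× b n) ⟨
    a ** n · b ** n   ∎

**-suc≋ : ∀ a n → a ** suc n ≋ a · a ** n
**-suc≋ a n rewrite **-suc a n = ≋-refl

**-one : ∀ a → a ** 1 ≋ a
**-one a rewrite **-suc a 0 | **-zero a = ·-identityʳ a

**-mono : ∀ {a b} n → a ≼ b → a ** n ≼ b ** n
**-mono {a} {b} zero    a≼b rewrite **-zero a | **-zero b = ≼-refl
**-mono {a} {b} (suc n) a≼b rewrite **-suc a n | **-suc b n = ·-mono a≼b (**-mono n a≼b)

**-cong : ∀ {a b} n → a ≋ b → a ** n ≋ b ** n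
**-cong n (a≼b , b≼a) = **-mono n a≼b , **-mono n b≼a

**-≥1 : ∀ {a} n → 1# ≼ a → 1# ≼ a ** n
**-≥1 {a} zero    1≼a rewrite **-zero a = ≼-refl
**-≥1 {a} (suc n) 1≼a rewrite **-suc a n = ≼-trans (proj₂ (·-identityˡ 1#)) (·-mono 1≼a (**-≥1 n 1≼a))

**-≤1 : ∀ {a} n → a ≼ 1# → a ** n ≼ 1#
**-≤1 {a} zero    a≼1 rewrite **-zero a = ≼-refl
**-≤1 {a} (suc n) a≼1 rewrite **-suc a n = ≼-trans (·-mono a≼1 (**-≤1 n a≼1)) (proj₁ (·-identityˡ 1#))

**-monoʳ : ∀ {a m n} → 1# ≼ a → m ℕ.≤ n → a ** m ≼ a ** n
**-monoʳ {a} {n = n} 1≼a ℕ.z≤n rewrite **-zero a = **-≥1 n 1≼a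
**-monoʳ {a} {suc m} {suc n} 1≼a (ℕ.s≤s m≤n) rewrite **-suc a m | **-suc a n = ·-monoʳ (**-monoʳ 1≼a m≤n)

**-antiʳ : ∀ {a m n} → a ≼ 1# → m ℕ.≤ n → a ** n ≼ a ** m
**-antiʳ {a} {n = n} a≼1 ℕ.z≤n rewrite **-zero a = **-≤1 n a≼1
**-antiʳ {a} {suc m} {suc n} a≼1 (ℕ.s≤s m≤n) rewrite **-suc a m | **-suc a n = ·-monoʳ (**-antiʳ a≼1 m≤n)

-- The invertible elements

Unit : [0,∞] → Set
Unit a = 0# ≺ a × a ≺ ∞#

Unit-resp : ∀ {a b} → a ≋ b → Unit a → Unit b
Unit-resp (a≼b , b≼a) (0≺a , a≺∞) = ≺-≼-trans 0≺a a≼b , ≼-≺-trans b≼a a≺∞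

⟨⟩-unit : ∀ {q} → 0ℚ ℚ.< q → Unit ⟨ q ⟩
⟨⟩-unit {q} 0<q =
  (λ q≼0 → ≤⇒≯ (⟨⟩-cancel ℚ.≤-refl q≼0) 0<q) ,
  (λ ∞≼q → ≤⇒≯ (⟨⟩-cancel {q ℚ.+ 1ℚ} (ℚ.<⇒≤ 0<q) (≼-trans ≼∞ ∞≼q))
    (subst (ℚ._< q ℚ.+ 1ℚ) (ℚ.+-identityʳ q) (ℚ.+-monoʳ-< q (ℚ.positive⁻¹ 1ℚ))))

1-unit : Unit 1#
1-unit = ⟨⟩-unit (ℚ.positive⁻¹ 1ℚ)

⟨⟩-· : ∀ {q r} → 0ℚ ℚ.≤ q → 0ℚ ℚ.≤ r → ⟨ q ⟩ · ⟨ r ⟩ ≋ ⟨ q ℚ.* r ⟩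
⟨⟩-· 0≤q 0≤r = ⟨⟩-·-≼ , ⟨⟩-·-≽ 0≤q 0≤r

module Inversion (lem : ExcludedMiddle 0ℓ) where
  open Separation lem

  ≼-total : ∀ a b → a ≼ b ⊎ b ≼ a
  ≼-total a b with lem {a ≼ b}
  ... | yes a≼b = inj₁ a≼b
  ... | no a⋠b  = inj₂ (≺⇒≼ a⋠b)

  data Magnitude (a : [0,∞]) : Set where
    null     : a ≋ 0# → Magnitude a
    unit     : Unit a → Magnitude a
    infinite : a ≋ ∞# → Magnitude a

  magnitude : ∀ a → Magnitude a
  magnitude a with lem {a ≼ 0#} | lem {∞# ≼ a}
  ... | yes a≼0 | _       = null (a≼0 , 0≼)
  ... | no _    | yes ∞≼a = infinite (≼∞ , ∞≼a)
  ... | no a⋠0  | no ∞⋠a  = unit (a⋠0 , ∞⋠a)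

  ·-inverseʳ : ∀ {a} → Unit a → a · a ⁻¹ ≋ 1#
  ·-inverseʳ {a} (0≺a , a≺∞) = ·-inverseʳ-≼ a , ·-inverseʳ-≽ 0≺a a≺∞

  ·-inverseˡ : ∀ {a} → Unit a → a ⁻¹ · a ≋ 1#
  ·-inverseˡ {a} u = ≋-trans (·-comm (a ⁻¹) a) (·-inverseʳ u)

  ·-·⁻¹ : ∀ {b} a → Unit b → a · b · b ⁻¹ ≋ a
  ·-·⁻¹ {b} a u = begin-equality
    a · b · b ⁻¹   ≈⟨ ·-assoc a b (b ⁻¹) ⟩
    a · (b · b ⁻¹) ≈⟨ ·-congˡ (·-inverseʳ u) ⟩
    a · 1#         ≈⟨ ·-identityʳ a ⟩
    a              ∎

  ·⁻¹-· : ∀ {b} a → Unit b → a · b ⁻¹ · b ≋ a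
  ·⁻¹-· {b} a u = begin-equality
    a · b ⁻¹ · b   ≈⟨ ·-assoc a (b ⁻¹) b ⟩
    a · (b ⁻¹ · b) ≈⟨ ·-congˡ (·-inverseˡ u) ⟩
    a · 1#         ≈⟨ ·-identityʳ a ⟩
    a              ∎

  ·≼⇒≼·⁻¹ : ∀ {a b c} → Unit b → a · b ≼ c → a ≼ c · b ⁻¹
  ·≼⇒≼·⁻¹ {a} {b} {c} u ab≼c = begin
    a             ≈⟨ ·-·⁻¹ a u ⟨
    a · b · b ⁻¹  ≤⟨ ·-monoˡ ab≼c ⟩
    c · b ⁻¹      ∎

  ≼·⁻¹⇒·≼ : ∀ {a b c} → Unit b → a ≼ c · b ⁻¹ → a · b ≼ c
  ≼·⁻¹⇒·≼ {a} {b} {c} u a≼cb⁻¹ = begin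
    a · b         ≤⟨ ·-monoˡ a≼cb⁻¹ ⟩
    c · b ⁻¹ · b  ≈⟨ ·⁻¹-· c u ⟩
    c             ∎

  ≼·⇒·⁻¹≼ : ∀ {a b c} → Unit b → a ≼ c · b → a · b ⁻¹ ≼ c
  ≼·⇒·⁻¹≼ {a} {b} {c} u a≼cb = begin
    a · b ⁻¹      ≤⟨ ·-monoˡ a≼cb ⟩
    c · b · b ⁻¹  ≈⟨ ·-·⁻¹ c u ⟩
    c             ∎

  ·⁻¹≼⇒≼· : ∀ {a b c} → Unit b → a · b ⁻¹ ≼ c → a ≼ c · b
  ·⁻¹≼⇒≼· {a} {b} {c} u ab⁻¹≼c = begin
    a             ≈⟨ ·⁻¹-· a u ⟨
    a · b ⁻¹ · b  ≤⟨ ·-monoˡ ab⁻¹≼c ⟩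
    c · b         ∎

  ·-cancelʳ-≼ : ∀ {a b c} → Unit c → a · c ≼ b · c → a ≼ b
  ·-cancelʳ-≼ {a} {b} {c} u ac≼bc = ≼-trans (·≼⇒≼·⁻¹ u ac≼bc) (proj₁ (·-·⁻¹ b u))

  -- `∞` is itself a multiple of `a`: `∞ = (∞ · a ⁻¹) · a ≤ ∞ · a`.
  ∞·-unit : ∀ {a} → Unit a → ∞# · a ≋ ∞#
  ∞·-unit {a} u = ≼∞ , ≼-trans (proj₂ (·⁻¹-· ∞# u)) (·-monoˡ ≼∞)

  ∞· : ∀ {a} → 0# ≺ a → ∞# · a ≋ ∞#
  ∞· {a} 0≺a with magnitude a
  ... | null a≋0     = ⊥-elim (0≺a (proj₁ a≋0))
  ... | unit u       = ∞·-unit u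
  ... | infinite a≋∞ = ≼∞ , (begin
    ∞#      ≈⟨ ∞·-unit 1-unit ⟨
    ∞# · 1# ≤⟨ ·-monoʳ ≼∞ ⟩
    ∞# · ∞# ≈⟨ ·-congˡ a≋∞ ⟨
    ∞# · a  ∎)

  ·∞ : ∀ {a} → 0# ≺ a → a · ∞# ≋ ∞#
  ·∞ {a} 0≺a = ≋-trans (·-comm a ∞#) (∞· 0≺a)

  ⁻¹-unit : ∀ {a} → Unit a → Unit (a ⁻¹)
  ⁻¹-unit {a} u@(0≺a , a≺∞) = 0≺a⁻¹ , a⁻¹≺∞
    where
    0≺a⁻¹ : 0# ≺ a ⁻¹
    0≺a⁻¹ a⁻¹≼0 = proj₁ 1-unit (begin
      1#       ≈⟨ ·-inverseʳ u ⟨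
      a · a ⁻¹ ≤⟨ ·-monoʳ a⁻¹≼0 ⟩
      a · 0#   ≈⟨ ·-zeroʳ a ⟩
      0#       ∎)
    a⁻¹≺∞ : a ⁻¹ ≺ ∞#
    a⁻¹≺∞ ∞≼a⁻¹ = proj₂ 1-unit (begin
      ∞#       ≈⟨ ·∞ 0≺a ⟨
      a · ∞#   ≤⟨ ·-monoʳ ∞≼a⁻¹ ⟩
      a · a ⁻¹ ≈⟨ ·-inverseʳ u ⟩
      1#       ∎)

  ·-unit : ∀ {a b} → Unit a → Unit b → Unit (a · b)
  ·-unit {a} {b} (0≺a , a≺∞) ub =
    (λ ab≼0 → 0≺a (≼-trans (·≼⇒≼·⁻¹ ub ab≼0) (proj₁ (·-zeroˡ (b ⁻¹))))) ,
    (λ ∞≼ab → a≺∞ (≼-trans (proj₂ (∞·-unit (⁻¹-unit ub))) (≼·⇒·⁻¹≼ ub ∞≼ab)))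

  ⁻¹-unique : ∀ {a b} → Unit a → a · b ≋ 1# → b ≋ a ⁻¹
  ⁻¹-unique {a} {b} u ab≋1 = begin-equality
    b             ≈⟨ ·-·⁻¹ b u ⟨
    b · a · a ⁻¹  ≈⟨ ·-congʳ (≋-trans (·-comm b a) ab≋1) ⟩
    1# · a ⁻¹     ≈⟨ ·-identityˡ (a ⁻¹) ⟩
    a ⁻¹          ∎

  ⁻¹-involutive : ∀ a → a ⁻¹ ⁻¹ ≋ a
  ⁻¹-involutive a with magnitude a
  ... | null a≋0     = ≋-trans (⁻¹-cong (≋-trans (⁻¹-cong a≋0) 0⁻¹)) (≋-trans ∞⁻¹ (≋-sym a≋0))
  ... | unit u       = ≋-sym (⁻¹-unique (⁻¹-unit u) (·-inverseˡ u))
  ... | infinite a≋∞ = ≋-trans (⁻¹-cong (≋-trans (⁻¹-cong a≋∞) ∞⁻¹)) (≋-trans 0⁻¹ (≋-sym a≋∞))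

  ⁻¹-injective : ∀ {a b} → a ⁻¹ ≋ b ⁻¹ → a ≋ b
  ⁻¹-injective {a} {b} eq = ≋-trans (≋-sym (⁻¹-involutive a)) (≋-trans (⁻¹-cong eq) (⁻¹-involutive b))

  -- Some restriction is necessary: for `0 · ∞` the left side is `∞` and the right side is `0`.
  ⁻¹-distrib-· : ∀ {b} a → Unit b → (a · b) ⁻¹ ≋ a ⁻¹ · b ⁻¹
  ⁻¹-distrib-· {b} a ub with magnitude a
  ... | null a≋0 = begin-equality
    (a · b) ⁻¹   ≈⟨ ⁻¹-cong (≋-trans (·-congʳ a≋0) (·-zeroˡ b)) ⟩
    0# ⁻¹        ≈⟨ 0⁻¹ ⟩
    ∞#           ≈⟨ ∞·-unit (⁻¹-unit ub) ⟨
    ∞# · b ⁻¹    ≈⟨ ·-congʳ (≋-trans (⁻¹-cong a≋0) 0⁻¹) ⟨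
    a ⁻¹ · b ⁻¹  ∎
  ... | infinite a≋∞ = begin-equality
    (a · b) ⁻¹   ≈⟨ ⁻¹-cong (≋-trans (·-congʳ a≋∞) (∞·-unit ub)) ⟩
    ∞# ⁻¹        ≈⟨ ∞⁻¹ ⟩
    0#           ≈⟨ ·-zeroˡ (b ⁻¹) ⟨
    0# · b ⁻¹    ≈⟨ ·-congʳ (≋-trans (⁻¹-cong a≋∞) ∞⁻¹) ⟨
    a ⁻¹ · b ⁻¹  ∎
  ... | unit ua = ≋-sym (⁻¹-unique (·-unit ua ub) (begin-equality
    a · b · (a ⁻¹ · b ⁻¹)    ≈⟨ ·-congˡ (·-comm (a ⁻¹) (b ⁻¹)) ⟩
    a · b · (b ⁻¹ · a ⁻¹)    ≈⟨ ·-assoc (a · b) (b ⁻¹) (a ⁻¹) ⟨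
    a · b · b ⁻¹ · a ⁻¹      ≈⟨ ·-congʳ (·-·⁻¹ a ub) ⟩
    a · a ⁻¹                 ≈⟨ ·-inverseʳ ua ⟩
    1#                       ∎))

  1⁻¹ : 1# ⁻¹ ≋ 1#
  1⁻¹ = ≋-sym (⁻¹-unique 1-unit (·-identityˡ 1#))

  ≤1⇒⁻¹≥1 : ∀ {a} → a ≼ 1# → 1# ≼ a ⁻¹
  ≤1⇒⁻¹≥1 a≼1 = ≼-trans (proj₂ 1⁻¹) (⁻¹-anti a≼1)

  ≥1⇒⁻¹≤1 : ∀ {a} → 1# ≼ a → a ⁻¹ ≼ 1#
  ≥1⇒⁻¹≤1 1≼a = ≼-trans (⁻¹-anti 1≼a) (proj₁ 1⁻¹)

  **-unit : ∀ {a} n → Unit a → Unit (a ** n)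
  **-unit {a} zero    u rewrite **-zero a = 1-unit
  **-unit {a} (suc n) u rewrite **-suc a n = ·-unit u (**-unit n u)

  0** : ∀ n → 0# ** suc n ≋ 0#
  0** n = ≋-trans (**-suc≋ 0# n) (·-zeroˡ (0# ** n))

  ∞** : ∀ n → ∞# ** suc n ≋ ∞#
  ∞** n = ≋-trans (**-suc≋ ∞# n) (∞· (≺-≼-trans (proj₁ 1-unit) (**-≥1 n ≼∞)))

  **-finite : ∀ {a} n → a ≺ ∞# → a ** n ≺ ∞#
  **-finite {a} n a≺∞ with magnitude a
  ... | null a≋0     = ≼-≺-trans (**-≤1 n (≼-trans (proj₁ a≋0) 0≼)) (proj₂ 1-unit)
  ... | unit u       = proj₂ (**-unit n u)
  ... | infinite a≋∞ = ⊥-elim (a≺∞ (proj₂ a≋∞))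

  **-⁻¹ : ∀ a n → (a ** n) ⁻¹ ≋ (a ⁻¹) ** n
  **-⁻¹ a zero rewrite **-zero a | **-zero (a ⁻¹) = 1⁻¹
  **-⁻¹ a (suc n) with magnitude a
  ... | null a≋0     = ≋-trans (⁻¹-cong (≋-trans (**-cong (suc n) a≋0) (0** n)))
    (≋-trans 0⁻¹ (≋-sym (≋-trans (**-cong (suc n) (≋-trans (⁻¹-cong a≋0) 0⁻¹)) (∞** n))))
  ... | infinite a≋∞ = ≋-trans (⁻¹-cong (≋-trans (**-cong (suc n) a≋∞) (∞** n)))
    (≋-trans ∞⁻¹ (≋-sym (≋-trans (**-cong (suc n) (≋-trans (⁻¹-cong a≋∞) ∞⁻¹)) (0** n))))
  ... | unit u = begin-equality
    (a ** suc n) ⁻¹       ≈⟨ ⁻¹-cong (**-suc≋ a n) ⟩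
    (a · a ** n) ⁻¹       ≈⟨ ⁻¹-distrib-· a (**-unit n u) ⟩
    a ⁻¹ · (a ** n) ⁻¹    ≈⟨ ·-congˡ (**-⁻¹ a n) ⟩
    a ⁻¹ · (a ⁻¹) ** n    ≈⟨ **-suc≋ (a ⁻¹) n ⟨
    (a ⁻¹) ** suc n       ∎

  -- If `b < a` with `a` invertible, then `a · a^k ≤ b · b^k ≤ b · a^k`, and cancelling `a^k`
  -- contradicts `b < a`. For `a = 0` nothing lies below `a`, and for `a = ∞` a power of the finite
  -- `b` would be infinite.
  **-cancel-≼ : ∀ {a b} k → a ** suc k ≼ b ** suc k → a ≼ b
  **-cancel-≼ {a} {b} k aⁿ≼bⁿ = ¬¬-elim λ b≺a → contradiction b≺a (magnitude a)
    where
    contradiction : b ≺ a → Magnitude a → _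
    contradiction b≺a (null a≋0)     = b≺a (≼-trans (proj₁ a≋0) 0≼)
    contradiction b≺a (infinite a≋∞) = **-finite (suc k) (≺-≼-trans b≺a ≼∞)
      (≼-trans (proj₂ (≋-trans (**-cong (suc k) a≋∞) (∞** k))) aⁿ≼bⁿ)
    contradiction b≺a (unit u)       = b≺a (·-cancelʳ-≼ (**-unit k u) (begin
      a · a ** k  ≈⟨ **-suc≋ a k ⟨
      a ** suc k  ≤⟨ aⁿ≼bⁿ ⟩
      b ** suc k  ≈⟨ **-suc≋ b k ⟩
      b · b ** k  ≤⟨ ·-monoʳ (**-mono k (≺⇒≼ b≺a)) ⟩
      b · a ** k  ∎))

  -- Limits from above fail at `0 · ∞`, where `c · ∞ = ∞` for every `c > 0`; for `a = ∞` the premise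
  -- would be vacuous. Finiteness of both factors excludes these. For invertible `b` one divides by
  -- it and uses density of the rationals.
  ·-rightContinuous : ∀ {a b d} → a ≺ ∞# → b ≺ ∞# → (∀ c → a ≺ c → c ≺ ∞# → d ≼ c · b) → d ≼ a · b
  ·-rightContinuous {a} {b} {d} a≺∞ b≺∞ h with magnitude b
  ... | infinite b≋∞ = ⊥-elim (b≺∞ (proj₂ b≋∞))
  ... | null b≋0 = let q , _ , a≺q , q≺∞ = ≺-dense a≺∞ in begin
    d         ≤⟨ h ⟨ q ⟩ a≺q q≺∞ ⟩
    ⟨ q ⟩ · b ≈⟨ ·-congˡ b≋0 ⟩
    ⟨ q ⟩ · 0# ≈⟨ ·-zeroʳ ⟨ q ⟩ ⟩
    0#        ≤⟨ 0≼ ⟩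
    a · b     ∎
  ... | unit u = ·⁻¹≼⇒≼· u (¬¬-elim λ a≺db⁻¹ →
    let q , _ , a≺q , q≺db⁻¹ = ≺-dense a≺db⁻¹
    in q≺db⁻¹ (≼·⇒·⁻¹≼ u (h ⟨ q ⟩ a≺q (≺-≼-trans q≺db⁻¹ ≼∞))))

  -- The factor `b` makes the induction work: one copy of `a` at a time is moved into it. `mixed`
  -- passes from a single approximation to two independent ones by applying `h` to the smaller, so
  -- that one can tend to `a` while the other stays fixed.
  **-rightContinuous : ∀ {a b d} n → a ≺ ∞# → b ≺ ∞# →
                       (∀ c → a ≺ c → c ≺ ∞# → d ≼ c ** n · b) → d ≼ a ** n · b
  **-rightContinuous {a} {b} {d} zero a≺∞ b≺∞ h =
    let q , _ , a≺q , q≺∞ = ≺-dense a≺∞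
    in subst (λ x → d ≼ x · b) (trans (**-zero ⟨ q ⟩) (sym (**-zero a))) (h ⟨ q ⟩ a≺q q≺∞)
  **-rightContinuous {a} {b} {d} (suc n) a≺∞ b≺∞ h = begin
    d                ≤⟨ **-rightContinuous n a≺∞ ab≺∞ step ⟩
    a ** n · (a · b) ≈⟨ x∙yz≈y∙xz (a ** n) a b ⟩
    a · (a ** n · b) ≈⟨ ·-assoc a (a ** n) b ⟨
    a · a ** n · b   ≈⟨ ·-congʳ (**-suc≋ a n) ⟨
    a ** suc n · b   ∎
    where
    ·-finite : ∀ {x y} → x ≺ ∞# → y ≺ ∞# → x · y ≺ ∞#
    ·-finite {x} {y} x≺∞ y≺∞ with magnitude x | magnitude y
    ... | infinite x≋∞ | _ = ⊥-elim (x≺∞ (proj₂ x≋∞))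
    ... | null x≋0 | _ = ≼-≺-trans (≼-trans (·-monoˡ (proj₁ x≋0)) (≼-trans (proj₁ (·-zeroˡ y)) 0≼)) (proj₂ 1-unit)
    ... | unit _ | infinite y≋∞ = ⊥-elim (y≺∞ (proj₂ y≋∞))
    ... | unit _ | null y≋0 = ≼-≺-trans (≼-trans (·-monoʳ (proj₁ y≋0)) (≼-trans (proj₁ (·-zeroʳ x)) 0≼)) (proj₂ 1-unit)
    ... | unit ux | unit uy = proj₂ (·-unit ux uy)
    ab≺∞ = ·-finite a≺∞ b≺∞
    mixed : ∀ c e → a ≺ c → c ≺ ∞# → a ≺ e → e ≺ ∞# → d ≼ e · (c ** n · b)
    mixed c e a≺c c≺∞ a≺e e≺∞ with ≼-total c e
    ... | inj₁ c≼e = begin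
      d                 ≤⟨ h c a≺c c≺∞ ⟩
      c ** suc n · b    ≈⟨ ·-congʳ (**-suc≋ c n) ⟩
      c · c ** n · b    ≈⟨ ·-assoc c (c ** n) b ⟩
      c · (c ** n · b)  ≤⟨ ·-monoˡ c≼e ⟩
      e · (c ** n · b)  ∎
    ... | inj₂ e≼c = begin
      d                 ≤⟨ h e a≺e e≺∞ ⟩
      e ** suc n · b    ≈⟨ ·-congʳ (**-suc≋ e n) ⟩
      e · e ** n · b    ≈⟨ ·-assoc e (e ** n) b ⟩
      e · (e ** n · b)  ≤⟨ ·-monoʳ (·-monoˡ (**-mono n e≼c)) ⟩
      e · (c ** n · b)  ∎
    step : ∀ c → a ≺ c → c ≺ ∞# → d ≼ c ** n · (a · b)
    step c a≺c c≺∞ = begin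
      d                ≤⟨ ·-rightContinuous a≺∞ (·-finite (**-finite n c≺∞) b≺∞)
                            (λ e → mixed c e a≺c c≺∞) ⟩
      a · (c ** n · b) ≈⟨ x∙yz≈y∙xz a (c ** n) b ⟩
      c ** n · (a · b) ∎

  -- The same induction, with `h` applied to the larger of the two approximations. For `n = 0` the
  -- power is 1 for any base, and `0# ≺ a` guarantees a base to which `h` applies.
  **-leftContinuous : ∀ {a b d} n → 0# ≺ a → (∀ c → c ≺ a → c ** n · b ≼ d) → a ** n · b ≼ d
  **-leftContinuous {a} {b} {d} zero 0≺a h =
    subst (λ x → x · b ≼ d) (trans (**-zero 0#) (sym (**-zero a))) (h 0# 0≺a)
  **-leftContinuous {a} {b} {d} (suc n) 0≺a h = begin
    a ** suc n · b   ≈⟨ ·-congʳ (**-suc≋ a n) ⟩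
    a · a ** n · b   ≈⟨ ·-assoc a (a ** n) b ⟩
    a · (a ** n · b) ≈⟨ x∙yz≈y∙xz a (a ** n) b ⟩
    a ** n · (a · b) ≤⟨ **-leftContinuous n 0≺a step ⟩
    d                ∎
    where
    mixed : ∀ c e → c ≺ a → e ≺ a → e · (c ** n · b) ≼ d
    mixed c e c≺a e≺a with ≼-total c e
    ... | inj₁ c≼e = begin
      e · (c ** n · b)  ≤⟨ ·-monoʳ (·-monoˡ (**-mono n c≼e)) ⟩
      e · (e ** n · b)  ≈⟨ ·-assoc e (e ** n) b ⟨
      e · e ** n · b    ≈⟨ ·-congʳ (**-suc≋ e n) ⟨
      e ** suc n · b    ≤⟨ h e e≺a ⟩
      d                 ∎
    ... | inj₂ e≼c = begin
      e · (c ** n · b)  ≤⟨ ·-monoˡ e≼c ⟩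
      c · (c ** n · b)  ≈⟨ ·-assoc c (c ** n) b ⟨
      c · c ** n · b    ≈⟨ ·-congʳ (**-suc≋ c n) ⟨
      c ** suc n · b    ≤⟨ h c c≺a ⟩
      d                 ∎
    step : ∀ c → c ≺ a → c ** n · (a · b) ≼ d
    step c c≺a = begin
      c ** n · (a · b) ≈⟨ x∙yz≈y∙xz (c ** n) a b ⟩
      a · (c ** n · b) ≤⟨ ·-leftContinuous (λ e → mixed c e c≺a) ⟩
      d                ∎

  ≺⋁ : ∀ {I : Set} (a : I → [0,∞]) {d} → d ≺ ⋁ a → ∃[ i ] d ≺ a i
  ≺⋁ a {d} d≺⋁ = ¬¬-elim λ none → d≺⋁ (⋁≼ a λ i → ¬¬-elim λ d≺ai → none (i , d≺ai))

  -- The supremum z of the powers satisfies z · a ≤ z, and z can be cancelled if it is finite.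
  **-bounded : ∀ {a b} → b ≺ ∞# → (∀ n → a ** n ≼ b) → a ≼ 1#
  **-bounded {a} {b} b≺∞ h = ·-cancelʳ-≼ z-unit (begin
    a · z   ≈⟨ ·-comm a z ⟩
    z · a   ≤⟨ ·-leftContinuous za≼z ⟩
    z       ≈⟨ ·-identityˡ z ⟨
    1# · z  ∎)
    where
    z : [0,∞]
    z = ⋁ (a **_)
    z-unit : Unit z
    z-unit = ≺-≼-trans (proj₁ 1-unit) (≼-trans (subst (1# ≼_) (sym (**-zero a)) ≼-refl) (≼⋁ (a **_) 0)) ,
             ≼-≺-trans (⋁≼ (a **_) h) b≺∞
    za≼z : ∀ c → c ≺ z → c · a ≼ z
    za≼z c c≺z = let n , c≺aⁿ = ≺⋁ (a **_) c≺z in begin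
      c · a         ≤⟨ ·-monoˡ (≺⇒≼ c≺aⁿ) ⟩
      a ** n · a    ≈⟨ ·-comm (a ** n) a ⟩
      a · a ** n    ≈⟨ **-suc≋ a n ⟨
      a ** suc n    ≤⟨ ≼⋁ (a **_) (suc n) ⟩
      z             ∎

-- Real powers

⟨frac⟩-cancel : ∀ {p} m k n j → ⟨ frac m k ⟩ ≼ p → p ≼ ⟨ frac n j ⟩ → m ℕ.* suc j ℕ.≤ n ℕ.* suc k
⟨frac⟩-cancel m k n j t≼p p≼t′ = frac-cancel {m} {k} {n} {j} (⟨⟩-cancel (frac-nonNeg n j) (≼-trans t≼p p≼t′))

frac-pos : ∀ m k → 0ℚ ℚ.< frac (suc m) k
frac-pos m k = *-pos⁻¹ˡ {frac (suc m) k} {frac (suc k) m} (frac-nonNeg (suc m) k)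
  (subst (0ℚ ℚ.<_) (sym (frac-inverse m k)) (ℚ.positive⁻¹ 1ℚ))

-- For a ≥ 1, y is the power a ^ p in the sense of Eudoxus.
record IsPower (a p y : [0,∞]) : Set where
  field
    1≼a   : 1# ≼ a
    lower : ∀ m k → ⟨ frac m k ⟩ ≼ p → a ** m ≼ y ** suc k
    upper : ∀ m k → p ≼ ⟨ frac m k ⟩ → y ** suc k ≼ a ** m

open IsPower

IsPower-resp : ∀ {a b p y z} → a ≋ b → y ≋ z → IsPower a p y → IsPower b p z
IsPower-resp a≋b y≋z P .1≼a = ≼-trans (1≼a P) (proj₁ a≋b)
IsPower-resp a≋b y≋z P .lower m k t≼p =
  ≼-trans (**-mono m (proj₂ a≋b)) (≼-trans (lower P m k t≼p) (**-mono (suc k) (proj₁ y≋z)))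
IsPower-resp a≋b y≋z P .upper m k p≼t =
  ≼-trans (**-mono (suc k) (proj₂ y≋z)) (≼-trans (upper P m k p≼t) (**-mono m (proj₁ a≋b)))

IsPower-≥1 : ∀ {a p y} → IsPower a p y → 1# ≼ y
IsPower-≥1 {a} {p} {y} P = begin
  1#      ≤⟨ **-≥1 0 (1≼a P) ⟩
  -- The fraction 0/1 lies below every `p`.
  a ** 0  ≤⟨ lower P 0 0 (subst (λ t → ⟨ t ⟩ ≼ p) (sym (frac-zero 0)) 0≼) ⟩
  y ** 1  ≈⟨ **-one y ⟩
  y       ∎

IsPower-· : ∀ {a b p y z} → IsPower a p y → IsPower b p z → IsPower (a · b) p (y · z)
IsPower-· P Q .1≼a = ≼-trans (proj₂ (·-identityˡ 1#)) (·-mono (1≼a P) (1≼a Q))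
IsPower-· {a} {b} {p} {y} {z} P Q .lower m k t≼p = begin
  (a · b) ** m           ≈⟨ **-distrib-· a b m ⟩
  a ** m · b ** m        ≤⟨ ·-mono (lower P m k t≼p) (lower Q m k t≼p) ⟩
  y ** suc k · z ** suc k ≈⟨ **-distrib-· y z (suc k) ⟨
  (y · z) ** suc k       ∎
IsPower-· {a} {b} {p} {y} {z} P Q .upper m k p≼t = begin
  (y · z) ** suc k       ≈⟨ **-distrib-· y z (suc k) ⟩
  y ** suc k · z ** suc k ≤⟨ ·-mono (upper P m k p≼t) (upper Q m k p≼t) ⟩
  a ** m · b ** m        ≈⟨ **-distrib-· a b m ⟨
  (a · b) ** m           ∎

module RealPowers (lem : ExcludedMiddle 0ℓ) where
  open Separation lem
  open Inversion lem

  -- a ^ p ≤ a ^ (m / suc k)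
  Over : [0,∞] → [0,∞] → ℕ → ℕ → Set
  Over a p m k = (1# ≼ a × p ≼ ⟨ frac m k ⟩) ⊎ (a ≼ 1# × ⟨ frac m k ⟩ ≼ p)

  -- The two fractions are compared over the common denominator `(k + 1)(j + 1)`. If the hypotheses
  -- put `a` on different sides of 1, both powers are compared with 1 instead.
  Under-Over : ∀ {a p} m k n j → Under a p m k → Over a p n j → a ** (m ℕ.* suc j) ≼ a ** (n ℕ.* suc k)
  Under-Over m k n j (inj₁ (1≼a , t≼p)) (inj₁ (_   , p≼t′)) = **-monoʳ 1≼a (⟨frac⟩-cancel m k n j t≼p p≼t′)
  Under-Over m k n j (inj₂ (a≼1 , p≼t)) (inj₂ (_   , t′≼p)) = **-antiʳ a≼1 (⟨frac⟩-cancel n j m k t′≼p p≼t)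
  Under-Over m k n j (inj₁ (1≼a , _))   (inj₂ (a≼1 , _))    =
    ≼-trans (**-≤1 (m ℕ.* suc j) a≼1) (**-≥1 (n ℕ.* suc k) 1≼a)
  Under-Over m k n j (inj₂ (a≼1 , _))   (inj₁ (1≼a , _))    =
    ≼-trans (**-≤1 (m ℕ.* suc j) a≼1) (**-≥1 (n ℕ.* suc k) 1≼a)

  -- If some `c` above `a ↑ p` had `c^(k+1) < a^m`, a rational between `a ↑ p` and `c` would belong
  -- to the set whose supremum is `a ↑ p`. Then `c` tends to `a ↑ p` from above, which requires
  -- `a ↑ p` to be finite.
  ↑-lowerBound : ∀ {a p} m k → Under a p m k → a ** m ≼ (a ↑ p) ** suc k
  ↑-lowerBound {a} {p} m k t≤p with lem {∞# ≼ a ↑ p}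
  ... | yes ∞≼aᵖ = ≼-trans ≼∞ (≼-trans (proj₂ (∞** k)) (**-mono (suc k) ∞≼aᵖ))
  ... | no aᵖ≺∞ = begin
    a ** m                  ≤⟨ **-rightContinuous (suc k) aᵖ≺∞ (proj₂ 1-unit) above ⟩
    (a ↑ p) ** suc k · 1#   ≈⟨ ·-identityʳ _ ⟩
    (a ↑ p) ** suc k        ∎
    where
    above : ∀ c → a ↑ p ≺ c → c ≺ ∞# → a ** m ≼ c ** suc k · 1#
    above c aᵖ≺c _ = ≼-trans (¬¬-elim λ cⁿ≺aᵐ →
      let q , 0<q , aᵖ≺q , q≺c = ≺-dense aᵖ≺c
      in aᵖ≺q (≼↑ m k (ℚ.<⇒≤ 0<q) t≤p
           (≼-trans (**-mono (suc k) (≺⇒≼ q≺c)) (≺⇒≼ cⁿ≺aᵐ))))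
      (proj₂ (·-identityʳ _))

  -- Each rational `q` contributing to the supremum obeys the bound: raise its own condition to the
  -- power `j + 1`, compare exponents, and cancel the power `k + 1`. The bound passes to the
  -- supremum by left continuity.
  ↑-upperBound : ∀ {a p} n j → Over a p n j → (a ↑ p) ** suc j ≼ a ** n
  ↑-upperBound {a} {p} n j p≤t with lem {a ↑ p ≼ 0#}
  ... | yes aᵖ≼0 = ≼-trans (**-mono (suc j) aᵖ≼0) (≼-trans (proj₁ (0** j)) 0≼)
  ... | no 0≺aᵖ = begin
    (a ↑ p) ** suc j        ≈⟨ ·-identityʳ _ ⟨
    (a ↑ p) ** suc j · 1#   ≤⟨ **-leftContinuous (suc j) 0≺aᵖ below ⟩
    a ** n                  ∎
    where
    rational : ∀ q m k → Under a p m k → ⟨ q ⟩ ** suc k ≼ a ** m → ⟨ q ⟩ ** suc j ≼ a ** n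
    rational q m k t≤p qᵏ≼aᵐ = **-cancel-≼ k (begin
      (⟨ q ⟩ ** suc j) ** suc k   ≈⟨ **-* ⟨ q ⟩ (suc j) (suc k) ⟩
      ⟨ q ⟩ ** (suc j ℕ.* suc k)  ≡⟨ cong (⟨ q ⟩ **_) (ℕ.*-comm (suc j) (suc k)) ⟩
      ⟨ q ⟩ ** (suc k ℕ.* suc j)  ≈⟨ **-* ⟨ q ⟩ (suc k) (suc j) ⟨
      (⟨ q ⟩ ** suc k) ** suc j   ≤⟨ **-mono (suc j) qᵏ≼aᵐ ⟩
      (a ** m) ** suc j           ≈⟨ **-* a m (suc j) ⟩
      a ** (m ℕ.* suc j)          ≤⟨ Under-Over m k n j t≤p p≤t ⟩
      a ** (n ℕ.* suc k)          ≈⟨ **-* a n (suc k) ⟨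
      (a ** n) ** suc k           ∎)
    below : ∀ c → c ≺ a ↑ p → c ** suc j · 1# ≼ a ** n
    below c c≺aᵖ = ≼-trans (proj₁ (·-identityʳ _)) (¬¬-elim λ aⁿ≺cʲ →
      c≺aᵖ (↑≼ λ q m k _ t≤p qᵏ≼aᵐ → ¬¬-elim λ c≺q →
        aⁿ≺cʲ (≼-trans (**-mono (suc j) (≺⇒≼ c≺q)) (rational q m k t≤p qᵏ≼aᵐ))))

  ↑-isPower : ∀ {a} p → 1# ≼ a → IsPower a p (a ↑ p)
  ↑-isPower p 1≼a = record
    { 1≼a   = 1≼a
    ; lower = λ m k t≼p → ↑-lowerBound m k (inj₁ (1≼a , t≼p))
    ; upper = λ m k p≼t → ↑-upperBound m k (inj₁ (1≼a , p≼t))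
    }

  ↑-isPower⁻¹ : ∀ {a} p → a ≼ 1# → IsPower (a ⁻¹) p ((a ↑ p) ⁻¹)
  ↑-isPower⁻¹ {a} p a≼1 = record
    { 1≼a   = ≤1⇒⁻¹≥1 a≼1
    ; lower = λ m k t≼p → begin
        (a ⁻¹) ** m               ≈⟨ **-⁻¹ a m ⟨
        (a ** m) ⁻¹               ≤⟨ ⁻¹-anti (↑-upperBound m k (inj₂ (a≼1 , t≼p))) ⟩
        ((a ↑ p) ** suc k) ⁻¹     ≈⟨ **-⁻¹ (a ↑ p) (suc k) ⟩
        ((a ↑ p) ⁻¹) ** suc k     ∎
    ; upper = λ m k p≼t → begin
        ((a ↑ p) ⁻¹) ** suc k     ≈⟨ **-⁻¹ (a ↑ p) (suc k) ⟨
        ((a ↑ p) ** suc k) ⁻¹     ≤⟨ ⁻¹-anti (↑-lowerBound m k (inj₂ (a≼1 , p≼t))) ⟩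
        (a ** m) ⁻¹               ≈⟨ **-⁻¹ a m ⟩
        (a ⁻¹) ** m               ∎
    }

  pos-frac : ∀ {q} → 0ℚ ℚ.< q → Σ[ m ∈ ℕ ] Σ[ k ∈ ℕ ] q ≡ frac (suc m) k
  pos-frac 0<q with nonNeg-frac (ℚ.<⇒≤ 0<q)
  ... | zero  , k , eq = ⊥-elim (ℚ.<-irrefl (sym (trans eq (frac-zero k))) 0<q)
  ... | suc m , k , eq = m , k , eq

  frac-below : ∀ {p} → 0# ≺ p → ∃[ m ] ∃[ k ] ⟨ frac (suc m) k ⟩ ≼ p
  frac-below {p} 0≺p =
    let q , 0<q , _ , q≺p = ≺-dense 0≺p
        m , k , q≡m/k = pos-frac 0<q
    in m , k , subst (λ t → ⟨ t ⟩ ≼ p) q≡m/k (≺⇒≼ q≺p)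

  frac-around : ∀ {p} k → p ≺ ∞# → ∃[ m ] ⟨ frac m k ⟩ ≼ p × p ≼ ⟨ frac (suc m) k ⟩
  frac-around {p} k p≺∞ =
    let q , _ , p≺q , _ = ≺-dense p≺∞
        M , q≤M = archimedean q
        -- The integer bound `M` is `M (k + 1)` over the denominator `k + 1`, so the search for `m`
        -- needs to go no further than `M (k + 1)`.
        q≤M/k = ℚ.≤-trans q≤M (frac-mono {M} {0} {M ℕ.* suc k} {k} (ℕ.≤-reflexive (sym (ℕ.*-identityʳ _))))
        m , m/k≼p , p≺m+1/k = first-failure (λ m → ⟨ frac m k ⟩ ≼ p) (M ℕ.* suc k)
          (subst (λ t → ⟨ t ⟩ ≼ p) (sym (frac-zero k)) 0≼)
          (≺-≼-trans p≺q (⟨⟩-mono q≤M/k))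
    in m , m/k≼p , ≺⇒≼ p≺m+1/k

  frac⁻¹ : ∀ m k → ⟨ frac (suc m) k ⟩ ⁻¹ ≋ ⟨ frac (suc k) m ⟩
  frac⁻¹ m k = ≋-sym (⁻¹-unique (⟨⟩-unit (frac-pos m k)) (begin-equality
    ⟨ t ⟩ · ⟨ t′ ⟩  ≈⟨ ⟨⟩-· (frac-nonNeg (suc m) k) (frac-nonNeg (suc k) m) ⟩
    ⟨ t ℚ.* t′ ⟩    ≡⟨ cong ⟨_⟩ (frac-inverse m k) ⟩
    1#              ∎))
    where
    t = frac (suc m) k
    t′ = frac (suc k) m

  module _ {p : [0,∞]} (p-unit : Unit p) where

    -- Since `0 < p`, a fraction with positive numerator lies below `p`; numerator 0 would bound `y`
    -- from below only by 1.
    IsPower-∞ : ∀ {y} → IsPower ∞# p y → ∞# ≼ y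
    IsPower-∞ {y} P = let m , k , t≼p = frac-below (proj₁ p-unit) in **-cancel-≼ k (begin
      ∞# ** suc k  ≤⟨ ≼∞ ⟩
      ∞#           ≈⟨ ∞** m ⟨
      ∞# ** suc m  ≤⟨ lower P (suc m) k t≼p ⟩
      y ** suc k   ∎)

    IsPower-finite : ∀ {a y} → a ≺ ∞# → IsPower a p y → y ≺ ∞#
    IsPower-finite {a} {y} a≺∞ P =
      let m , _ , p≼t = frac-around 0 (proj₂ p-unit)
      in ≼-≺-trans (≼-trans (proj₂ (**-one y)) (upper P (suc m) 0 p≼t)) (**-finite (suc m) a≺∞)

    -- For finite `a` and `m/n ≤ p ≤ (m+1)/n`, one has `y^n ≤ a · a^m ≤ a · z^n`. So all powers of
    -- `y/z` are bounded by `a`, and `**-bounded` gives `y/z ≤ 1`.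
    IsPower-≼ : ∀ {a y z} → IsPower a p y → IsPower a p z → y ≼ z
    IsPower-≼ {a} {y} {z} P Q with lem {∞# ≼ a}
    ... | yes ∞≼a = ≼-trans ≼∞ (IsPower-∞ (IsPower-resp (≼∞ , ∞≼a) ≋-refl Q))
    ... | no a≺∞ = begin
      y           ≈⟨ ·⁻¹-· y z-unit ⟨
      y · z ⁻¹ · z ≤⟨ ·-monoˡ (**-bounded a≺∞ ratio) ⟩
      1# · z      ≈⟨ ·-identityˡ z ⟩
      z           ∎
      where
      z-unit : Unit z
      z-unit = ≺-≼-trans (proj₁ 1-unit) (IsPower-≥1 Q) , IsPower-finite a≺∞ Q
      ratio : ∀ n → (y · z ⁻¹) ** n ≼ a
      ratio zero    = subst (_≼ a) (sym (**-zero _)) (1≼a P)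
      ratio (suc k) = let m , m/k≼p , p≼m+1/k = frac-around k (proj₂ p-unit) in begin
        (y · z ⁻¹) ** suc k           ≈⟨ **-distrib-· y (z ⁻¹) (suc k) ⟩
        y ** suc k · (z ⁻¹) ** suc k  ≈⟨ ·-congˡ (**-⁻¹ z (suc k)) ⟨
        y ** suc k · (z ** suc k) ⁻¹  ≤⟨ ≼·⇒·⁻¹≼ (**-unit (suc k) z-unit) (begin
          y ** suc k       ≤⟨ upper P (suc m) k p≼m+1/k ⟩
          a ** suc m       ≈⟨ **-suc≋ a m ⟩
          a · a ** m       ≤⟨ ·-monoʳ (lower Q m k m/k≼p) ⟩
          a · z ** suc k   ∎) ⟩
        a                             ∎

    IsPower-unique : ∀ {a y z} → IsPower a p y → IsPower a p z → y ≋ z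
    IsPower-unique P Q = IsPower-≼ P Q , IsPower-≼ Q P

    -- `m/n ≤ 1/p` means `p ≤ n/m`, so the two bounds trade places. Numerator 0 has no reciprocal
    -- and is treated apart: there the lower bound is `1 ≤ a^n`, and the upper one never applies
    -- because `1/p > 0`.
    IsPower-inverse : ∀ {a y} → IsPower a p y → IsPower y (p ⁻¹) a
    IsPower-inverse P .1≼a = IsPower-≥1 P
    IsPower-inverse {a} {y} P .lower zero k _ =
      subst (_≼ a ** suc k) (sym (**-zero y)) (**-≥1 (suc k) (1≼a P))
    IsPower-inverse P .lower (suc m) k t≼p⁻¹ = upper P (suc k) m (begin
      p                      ≈⟨ ⁻¹-involutive p ⟨
      p ⁻¹ ⁻¹                ≤⟨ ⁻¹-anti t≼p⁻¹ ⟩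
      ⟨ frac (suc m) k ⟩ ⁻¹  ≈⟨ frac⁻¹ m k ⟩
      ⟨ frac (suc k) m ⟩     ∎)
    IsPower-inverse P .upper zero k p⁻¹≼0 =
      ⊥-elim (proj₁ (⁻¹-unit p-unit) (subst (λ t → p ⁻¹ ≼ ⟨ t ⟩) (frac-zero k) p⁻¹≼0))
    IsPower-inverse P .upper (suc m) k p⁻¹≼t = lower P (suc k) m (begin
      ⟨ frac (suc k) m ⟩     ≈⟨ frac⁻¹ m k ⟨
      ⟨ frac (suc m) k ⟩ ⁻¹  ≤⟨ ⁻¹-anti p⁻¹≼t ⟩
      p ⁻¹ ⁻¹                ≈⟨ ⁻¹-involutive p ⟩
      p                      ∎)

    ↑-cong : ∀ {a b} → a ≋ b → a ↑ p ≋ b ↑ p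
    ↑-cong {a} {b} a≋b with ≼-total 1# a
    ... | inj₁ 1≼a = IsPower-unique (IsPower-resp a≋b ≋-refl (↑-isPower p 1≼a))
      (↑-isPower p (≼-trans 1≼a (proj₁ a≋b)))
    ... | inj₂ a≼1 = ⁻¹-injective (IsPower-unique (IsPower-resp (⁻¹-cong a≋b) ≋-refl (↑-isPower⁻¹ p a≼1))
      (↑-isPower⁻¹ p (≼-trans (proj₂ a≋b) a≼1)))

    ↑-⁻¹ : ∀ a → (a ⁻¹) ↑ p ≋ (a ↑ p) ⁻¹
    ↑-⁻¹ a with ≼-total 1# a
    ... | inj₁ 1≼a = ⁻¹-injective (IsPower-unique (↑-isPower⁻¹ p (≥1⇒⁻¹≤1 1≼a))
      (IsPower-resp (≋-sym (⁻¹-involutive a)) (≋-sym (⁻¹-involutive (a ↑ p))) (↑-isPower p 1≼a)))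
    ... | inj₂ a≼1 = IsPower-unique (↑-isPower p (≤1⇒⁻¹≥1 a≼1)) (↑-isPower⁻¹ p a≼1)

    ↑-≥1 : ∀ {a} → 1# ≼ a → 1# ≼ a ↑ p
    ↑-≥1 1≼a = IsPower-≥1 (↑-isPower p 1≼a)

    ↑-≤1 : ∀ {a} → a ≼ 1# → a ↑ p ≼ 1#
    ↑-≤1 {a} a≼1 = begin
      a ↑ p           ≈⟨ ⁻¹-involutive (a ↑ p) ⟨
      (a ↑ p) ⁻¹ ⁻¹   ≤⟨ ≥1⇒⁻¹≤1 (IsPower-≥1 (↑-isPower⁻¹ p a≼1)) ⟩
      1#              ∎

    ∞↑ : ∞# ↑ p ≋ ∞#
    ∞↑ = ≼∞ , IsPower-∞ (↑-isPower p ≼∞)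

    0↑ : 0# ↑ p ≋ 0#
    0↑ = begin-equality
      0# ↑ p          ≈⟨ ↑-cong ∞⁻¹ ⟨
      (∞# ⁻¹) ↑ p     ≈⟨ ↑-⁻¹ ∞# ⟩
      (∞# ↑ p) ⁻¹     ≈⟨ ⁻¹-cong ∞↑ ⟩
      ∞# ⁻¹           ≈⟨ ∞⁻¹ ⟩
      0#              ∎

    ↑-unit : ∀ {a} → Unit a → Unit (a ↑ p)
    ↑-unit {a} u@(_ , a≺∞) with ≼-total 1# a
    ... | inj₁ 1≼a = ≺-≼-trans (proj₁ 1-unit) (↑-≥1 1≼a) , IsPower-finite a≺∞ (↑-isPower p 1≼a)
    ... | inj₂ a≼1 = Unit-resp (⁻¹-involutive (a ↑ p)) (⁻¹-unit
      (≺-≼-trans (proj₁ 1-unit) (IsPower-≥1 P) , IsPower-finite (proj₂ (⁻¹-unit u)) P))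
      where P = ↑-isPower⁻¹ p a≼1

    ↑-positive : ∀ {a} → 0# ≺ a → 0# ≺ a ↑ p
    ↑-positive {a} 0≺a with magnitude a
    ... | null a≋0     = ⊥-elim (0≺a (proj₁ a≋0))
    ... | unit u       = proj₁ (↑-unit u)
    ... | infinite a≋∞ = ≺-≼-trans (≺-≼-trans (proj₁ 1-unit) ≼∞) (proj₂ (≋-trans (↑-cong a≋∞) ∞↑))

    ↑-·-≥1 : ∀ {a b} → 1# ≼ a → 1# ≼ b → (a · b) ↑ p ≋ a ↑ p · b ↑ p
    ↑-·-≥1 1≼a 1≼b = let P = IsPower-· (↑-isPower p 1≼a) (↑-isPower p 1≼b)
      in IsPower-unique (↑-isPower p (IsPower.1≼a P)) P

    -- If a ≤ 1 ≤ b, one of a b and (a b)⁻¹ is at least 1, and the product formula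
    -- for that element and b or a⁻¹ is rearranged.
    ↑-·-unit≥1 : ∀ {b} a → Unit b → 1# ≼ b → (a · b) ↑ p ≋ a ↑ p · b ↑ p
    ↑-·-unit≥1 {b} a ub 1≼b with ≼-total 1# a
    ... | inj₁ 1≼a = ↑-·-≥1 1≼a 1≼b
    ... | inj₂ a≼1 with ≼-total 1# (a · b)
    ...   | inj₁ 1≼ab = begin-equality
      (a · b) ↑ p                              ≈⟨ ·⁻¹-· ((a · b) ↑ p) (↑-unit ua) ⟨
      (a · b) ↑ p · (a ↑ p) ⁻¹ · a ↑ p         ≈⟨ ·-congʳ (·-congˡ (↑-⁻¹ a)) ⟨
      (a · b) ↑ p · (a ⁻¹) ↑ p · a ↑ p         ≈⟨ ·-congʳ (↑-·-≥1 1≼ab (≤1⇒⁻¹≥1 a≼1)) ⟨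
      (a · b · a ⁻¹) ↑ p · a ↑ p               ≈⟨ ·-congʳ (↑-cong (·-congʳ (·-comm a b))) ⟩
      (b · a · a ⁻¹) ↑ p · a ↑ p               ≈⟨ ·-congʳ (↑-cong (·-·⁻¹ b ua)) ⟩
      b ↑ p · a ↑ p                            ≈⟨ ·-comm (b ↑ p) (a ↑ p) ⟩
      a ↑ p · b ↑ p                            ∎
      where
      ua : Unit a
      ua = (λ a≼0 → proj₁ 1-unit (≼-trans 1≼ab (≼-trans (·-monoˡ a≼0) (proj₁ (·-zeroˡ b))))) ,
           ≼-≺-trans a≼1 (proj₂ 1-unit)
    ...   | inj₂ ab≼1 = ⁻¹-injective (begin-equality
      ((a · b) ↑ p) ⁻¹                          ≈⟨ ↑-⁻¹ (a · b) ⟨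
      ((a · b) ⁻¹) ↑ p                          ≈⟨ ·-·⁻¹ (((a · b) ⁻¹) ↑ p) (↑-unit ub) ⟨
      ((a · b) ⁻¹) ↑ p · b ↑ p · (b ↑ p) ⁻¹     ≈⟨ ·-congʳ (↑-·-≥1 (≤1⇒⁻¹≥1 ab≼1) 1≼b) ⟨
      ((a · b) ⁻¹ · b) ↑ p · (b ↑ p) ⁻¹         ≈⟨ ·-congʳ (↑-cong (·-congʳ (⁻¹-distrib-· a ub))) ⟩
      (a ⁻¹ · b ⁻¹ · b) ↑ p · (b ↑ p) ⁻¹        ≈⟨ ·-congʳ (↑-cong (·⁻¹-· (a ⁻¹) ub)) ⟩
      (a ⁻¹) ↑ p · (b ↑ p) ⁻¹                   ≈⟨ ·-congʳ (↑-⁻¹ a) ⟩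
      (a ↑ p) ⁻¹ · (b ↑ p) ⁻¹                   ≈⟨ ⁻¹-distrib-· (a ↑ p) (↑-unit ub) ⟨
      (a ↑ p · b ↑ p) ⁻¹                        ∎)

    ↑-· : ∀ {b} a → Unit b → (a · b) ↑ p ≋ a ↑ p · b ↑ p
    ↑-· {b} a ub with ≼-total 1# b
    ... | inj₁ 1≼b = ↑-·-unit≥1 a ub 1≼b
    ... | inj₂ b≼1 = ⁻¹-injective (begin-equality
      ((a · b) ↑ p) ⁻¹          ≈⟨ ↑-⁻¹ (a · b) ⟨
      ((a · b) ⁻¹) ↑ p          ≈⟨ ↑-cong (⁻¹-distrib-· a ub) ⟩
      (a ⁻¹ · b ⁻¹) ↑ p         ≈⟨ ↑-·-unit≥1 (a ⁻¹) (⁻¹-unit ub) (≤1⇒⁻¹≥1 b≼1) ⟩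
      (a ⁻¹) ↑ p · (b ⁻¹) ↑ p   ≈⟨ ·-cong (↑-⁻¹ a) (↑-⁻¹ b) ⟩
      (a ↑ p) ⁻¹ · (b ↑ p) ⁻¹   ≈⟨ ⁻¹-distrib-· (a ↑ p) (↑-unit ub) ⟨
      (a ↑ p · b ↑ p) ⁻¹        ∎)

    -- Write `a = (a/b) · b`; the power of `a/b ≤ 1` is at most 1.
    ↑-mono : ∀ {a b} → a ≼ b → a ↑ p ≼ b ↑ p
    ↑-mono {a} {b} a≼b with magnitude b
    ... | null b≋0     = proj₁ (↑-cong (a≼b , ≼-trans (proj₁ b≋0) 0≼))
    ... | infinite b≋∞ = ≼-trans ≼∞ (proj₂ (≋-trans (↑-cong b≋∞) ∞↑))
    ... | unit ub = begin
      a ↑ p                  ≈⟨ ↑-cong (·⁻¹-· a ub) ⟨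
      (a · b ⁻¹ · b) ↑ p     ≈⟨ ↑-· (a · b ⁻¹) ub ⟩
      (a · b ⁻¹) ↑ p · b ↑ p ≤⟨ ·-monoˡ (↑-≤1 (≼·⇒·⁻¹≼ ub (≼-trans a≼b (proj₂ (·-identityˡ b))))) ⟩
      1# · b ↑ p             ≈⟨ ·-identityˡ (b ↑ p) ⟩
      b ↑ p                  ∎

    IsPower-identity : ∀ {a} → p ≋ 1# → 1# ≼ a → IsPower a p a
    IsPower-identity (p≼1 , 1≼p) 1≼a = record
      { 1≼a   = 1≼a
      ; lower = λ m k t≼p → **-monoʳ 1≼a (subst₂ ℕ._≤_ (ℕ.*-identityʳ m) (ℕ.*-identityˡ (suc k))
          (⟨frac⟩-cancel m k 1 0 t≼p (subst (λ t → p ≼ ⟨ t ⟩) (sym frac-one) p≼1)))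
      ; upper = λ m k p≼t → **-monoʳ 1≼a (subst₂ ℕ._≤_ (ℕ.*-identityˡ (suc k)) (ℕ.*-identityʳ m)
          (⟨frac⟩-cancel 1 0 m k (subst (λ t → ⟨ t ⟩ ≼ p) (sym frac-one) 1≼p) p≼t))
      }

    -- The exponent is 1 up to `≋`, which covers the outer exponent `1# ⁻¹` as well.
    ↑-identity : p ≋ 1# → ∀ a → a ↑ p ≋ a
    ↑-identity p≋1 a with ≼-total 1# a
    ... | inj₁ 1≼a = IsPower-unique (↑-isPower p 1≼a) (IsPower-identity p≋1 1≼a)
    ... | inj₂ a≼1 = ⁻¹-injective (IsPower-unique (↑-isPower⁻¹ p a≼1) (IsPower-identity p≋1 (≤1⇒⁻¹≥1 a≼1)))

  ↑-inverse : ∀ {p} → Unit p → ∀ a → (a ↑ p) ↑ p ⁻¹ ≋ a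
  ↑-inverse {p} p-unit a with ≼-total 1# a
  ... | inj₁ 1≼a = IsPower-unique (⁻¹-unit p-unit)
    (↑-isPower (p ⁻¹) (↑-≥1 p-unit 1≼a)) (IsPower-inverse p-unit (↑-isPower p 1≼a))
  ... | inj₂ a≼1 = ⁻¹-injective (IsPower-unique (⁻¹-unit p-unit)
    (↑-isPower⁻¹ (p ⁻¹) (↑-≤1 p-unit a≼1)) (IsPower-inverse p-unit (↑-isPower⁻¹ p a≼1)))

opaque
  unfolding _≼_

  ≈⇒≋ : ∀ a b → a ≈ b → a ≋ b
  ≈⇒≋ a b a≈b = a≈b

-- The integral

∑-null : ∀ {n} (a : Fin n → [0,∞]) → (∀ i → a i ≼ 0#) → ∑ a ≼ 0#
∑-null {zero}  a h = ≼-refl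
∑-null {suc n} a h = ≼-trans (⊕-mono (h zero) (∑-null (a ∘ suc) (h ∘ suc))) 0⊕0≼0

∑-mono : ∀ {n} (a b : Fin n → [0,∞]) → (∀ i → a i ≼ b i) → ∑ a ≼ ∑ b
∑-mono {zero}  a b h = ≼-refl
∑-mono {suc n} a b h = ⊕-mono (h zero) (∑-mono (a ∘ suc) (b ∘ suc) (h ∘ suc))

≼∑ : ∀ {n} (a : Fin n → [0,∞]) i → a i ≼ ∑ a
≼∑ a zero    = ≼⊕ˡ (a zero) (∑ (a ∘ suc))
≼∑ a (suc i) = ≼-trans (≼∑ (a ∘ suc) i) (≼⊕ʳ (a zero) (∑ (a ∘ suc)))

⟨⟩-distrib-∑ : ∀ {n} q (a : Fin n → [0,∞]) → ⟨ q ⟩ · ∑ a ≼ ∑ (λ i → ⟨ q ⟩ · a i)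
⟨⟩-distrib-∑ {zero}  q a = proj₁ (·-zeroʳ ⟨ q ⟩)
⟨⟩-distrib-∑ {suc n} q a = ≼-trans (⟨⟩-distrib-⊕ q (a zero) (∑ (a ∘ suc)))
  (⊕-mono {⟨ q ⟩ · a zero} {⟨ q ⟩ · a zero} {⟨ q ⟩ · ∑ (a ∘ suc)} {∑ (λ i → ⟨ q ⟩ · a (suc i))}
    ≼-refl (⟨⟩-distrib-∑ q (a ∘ suc)))

module Measure (lem : ExcludedMiddle 0ℓ) (M : MeasureSpace) where
  open Separation lem
  open Inversion lem
  open RealPowers lem
  open MeasureSpace M
  open Integration M

  module Simple (s : SimpleFunction) where
    open SimpleFunction s public

    term : Fin size → [0,∞]
    term i = ⟨ value i ⟩ · μ (λ x → label x ≡ i) (fibre i)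

  opaque
    unfolding _≼_

    integral≡∑ : ∀ s → SimpleFunction.integral s ≡ ∑ (Simple.term s)
    integral≡∑ s = refl

    integral≼∫ : ∀ s g → (∀ x → SimpleFunction.eval s x ≼ g x) → SimpleFunction.integral s ≼ ∫ g
    integral≼∫ s g s≼g = ≼⋁ (λ (s , _) → SimpleFunction.integral s) (s , s≼g)

    ∫≼ : ∀ g {d} → (∀ s → (∀ x → SimpleFunction.eval s x ≼ g x) → SimpleFunction.integral s ≼ d) → ∫ g ≼ d
    ∫≼ g {d} h = ⋁≼ {Σ[ s ∈ SimpleFunction ] (∀ x → SimpleFunction.eval s x ≼ g x)}
      (λ (s , _) → SimpleFunction.integral s) {d} (λ (s , s≼g) → h s s≼g)

    measurable-≺ : ∀ {f} → MeasurableFunction f → ∀ a → Measurable (λ x → a ≺ f x)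
    measurable-≺ mf = mf

  ∫-mono : ∀ {g h} → (∀ x → g x ≼ h x) → ∫ g ≼ ∫ h
  ∫-mono {g} {h} g≼h = ∫≼ g λ s s≼g → integral≼∫ s h λ x → ≼-trans (s≼g x) (g≼h x)

  ∫-cong : ∀ {g h} → (∀ x → g x ≋ h x) → ∫ g ≋ ∫ h
  ∫-cong g≋h = ∫-mono (proj₁ ∘ g≋h) , ∫-mono (proj₂ ∘ g≋h)

  scale : ∀ q → 0ℚ ℚ.≤ q → SimpleFunction → SimpleFunction
  scale q 0≤q s = record
    { size    = size
    ; label   = label
    ; fibre   = fibre
    ; value   = λ i → q ℚ.* value i
    ; value≥0 = λ i → *-nonNeg 0≤q (value≥0 i)
    }
    where open SimpleFunction s

  integral-scale : ∀ q (0≤q : 0ℚ ℚ.≤ q) s →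
                   ⟨ q ⟩ · SimpleFunction.integral s ≼ SimpleFunction.integral (scale q 0≤q s)
  integral-scale q 0≤q s = begin
    ⟨ q ⟩ · integral                    ≡⟨ cong (⟨ q ⟩ ·_) (integral≡∑ s) ⟩
    ⟨ q ⟩ · ∑ term                      ≤⟨ ⟨⟩-distrib-∑ q term ⟩
    ∑ (λ i → ⟨ q ⟩ · term i)            ≤⟨ ∑-mono _ (Simple.term qs) (λ i → begin
      ⟨ q ⟩ · (⟨ value i ⟩ · m i)         ≈⟨ ·-assoc ⟨ q ⟩ ⟨ value i ⟩ (m i) ⟨
      ⟨ q ⟩ · ⟨ value i ⟩ · m i           ≤⟨ ·-monoˡ ⟨⟩-·-≼ ⟩
      ⟨ q ℚ.* value i ⟩ · m i             ∎) ⟩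
    ∑ (Simple.term qs)                  ≡⟨ integral≡∑ qs ⟨
    SimpleFunction.integral qs          ∎
    where
    open Simple s
    qs = scale q 0≤q s
    m : Fin size → [0,∞]
    m i = μ (λ x → label x ≡ i) (fibre i)

  -- Two limits from below: `∫ g` is replaced by the integral of a simple function `s` below `g`,
  -- then `c` by a rational `q` below `c`, and `q · s` is a simple function below `c · g`. No
  -- invertibility is assumed, so that `c = ∞` is available.
  ·∫≼∫· : ∀ c g → c · ∫ g ≼ ∫ (λ x → c · g x)
  ·∫≼∫· c g = begin
    c · ∫ g              ≈⟨ ·-comm c (∫ g) ⟩
    ∫ g · c              ≤⟨ ·-leftContinuous (λ d d≺∫g → ¬¬-elim λ ≺dc →
                              d≺∫g (∫≼ g λ s s≼g → ¬¬-elim λ d≺s →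
                                ≺dc (≼-trans (·-monoˡ (≺⇒≼ d≺s)) (simple s s≼g)))) ⟩
    ∫ (λ x → c · g x)    ∎
    where
    simple : ∀ s → (∀ x → SimpleFunction.eval s x ≼ g x) → SimpleFunction.integral s · c ≼ ∫ (λ x → c · g x)
    simple s s≼g = begin
      integral · c       ≈⟨ ·-comm integral c ⟩
      c · integral       ≤⟨ ·-leftContinuous (λ d d≺c →
        let q , 0≤q , d≼q , q≺c = ≺-rational d≺c in begin
          d · integral      ≤⟨ ·-monoˡ d≼q ⟩
          ⟨ q ⟩ · integral  ≤⟨ integral-scale q 0≤q s ⟩
          SimpleFunction.integral (scale q 0≤q s) ≤⟨ integral≼∫ (scale q 0≤q s) (λ x → c · g x) (λ x →
            ≼-trans (⟨⟩-·-≽ 0≤q (value≥0 (label x))) (·-mono (≺⇒≼ q≺c) (s≼g x))) ⟩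
          ∫ (λ x → c · g x) ∎) ⟩
      ∫ (λ x → c · g x)  ∎
      where open SimpleFunction s

  -- The inequality from left to right is `·∫≼∫·` for the constant `c ⁻¹` and the function `g · c`.
  ∫-· : ∀ {c} g → Unit c → ∫ (λ x → g x · c) ≋ ∫ g · c
  ∫-· {c} g u = ·⁻¹≼⇒≼· u (begin
    ∫ (λ x → g x · c) · c ⁻¹      ≈⟨ ·-comm _ (c ⁻¹) ⟩
    c ⁻¹ · ∫ (λ x → g x · c)      ≤⟨ ·∫≼∫· (c ⁻¹) (λ x → g x · c) ⟩
    ∫ (λ x → c ⁻¹ · (g x · c))    ≈⟨ ∫-cong (λ x → ≋-trans (·-comm (c ⁻¹) (g x · c)) (·-·⁻¹ (g x) u)) ⟩
    ∫ g                           ∎) ,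
    (begin
    ∫ g · c                       ≈⟨ ·-comm (∫ g) c ⟩
    c · ∫ g                       ≤⟨ ·∫≼∫· c g ⟩
    ∫ (λ x → c · g x)             ≈⟨ ∫-cong (λ x → ·-comm c (g x)) ⟩
    ∫ (λ x → g x · c)             ∎)

  -- Null sets

  measurable-∅ : Measurable ∅
  measurable-∅ = resp-≐ ((λ ¬⊤ → ¬⊤ _) , λ ()) (complement whole)

  -- De Morgan, with the union of two sets padded to the sequence `∁ A`, `∁ B`, `∁ B`, ...
  measurable-∩ : ∀ {A B} → Measurable A → Measurable B → Measurable (A ∩ B)
  measurable-∩ {A} {B} mA mB = resp-≐ (to , from) (complement (union mD))
    where
    D : ℕ → Pred X 0ℓ
    D zero    = ∁ A
    D (suc _) = ∁ B
    mD : ∀ n → Measurable (D n)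
    mD zero    = complement mA
    mD (suc _) = complement mB
    to : ∁ (⋃ ℕ D) ⊆ A ∩ B
    to x∉ = ¬¬-elim (λ x∉A → x∉ (0 , x∉A)) , ¬¬-elim (λ x∉B → x∉ (1 , x∉B))
    from : A ∩ B ⊆ ∁ (⋃ ℕ D)
    from (x∈A , x∈B) (zero  , x∉A) = x∉A x∈A
    from (x∈A , x∈B) (suc _ , x∉B) = x∉B x∈B

  -- N need not be measurable.
  Null : Pred X 0ℓ → Set₁
  Null N = ∀ {A} (mA : Measurable A) → A ⊆ N → μ A mA ≼ 0#

  null-∅ : Null ∅
  null-∅ {A} mA A⊆∅ = ≼-trans (proj₁ (≈⇒≋ (μ A mA) (μ ∅ measurable-∅) (μ-cong mA measurable-∅ (A⊆∅ , λ ()))))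
    (proj₁ (≈⇒≋ (μ ∅ measurable-∅) 0# (μ-∅ measurable-∅)))

  -- Additivity speaks of disjoint unions, so `A` is partitioned by the first index `n` with `x` in
  -- `E n`. Each piece is a measurable subset of `E n`, hence of measure 0.
  null-⋃ : ∀ (E : ℕ → Pred X 0ℓ) → (∀ n → Measurable (E n)) → (∀ n → Null (E n)) → Null (⋃ ℕ E)
  null-⋃ E mE nullE {A} mA A⊆⋃E = begin
    μ A mA                        ≈⟨ ≈⇒≋ (μ A mA) (μ (⋃ ℕ D) (union mD)) (μ-cong mA (union mD) (A⊆⋃D , λ (_ , x∈A , _) → x∈A)) ⟩
    μ (⋃ ℕ D) (union mD)          ≈⟨ ≈⇒≋ (μ (⋃ ℕ D) (union mD)) (∑∞ (λ n → μ (D n) (mD n))) (μ-union mD disjoint) ⟩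
    ∑∞ (λ n → μ (D n) (mD n))     ≤⟨ ⋁≼ _ (λ N → ∑-null {N} _ λ i → nullE _ (mD _) (λ (_ , x∈En , _) → x∈En)) ⟩
    0#                            ∎
    where
    Before : ℕ → Pred X 0ℓ
    Before n x = ∀ k → k ℕ.< n → ¬ E k x

    mBefore : ∀ n → Measurable (Before n)
    mBefore n = resp-≐ ((λ x∉ k k<n x∈Ek → x∉ (k , k<n , x∈Ek)) , λ before (k , k<n , x∈Ek) → before k k<n x∈Ek)
      (complement (union λ k → restrict k (k ℕ.<? n)))
      where
      -- The condition `k < n` does not depend on `x`, so each set of the union is `E k` or empty.
      restrict : ∀ k → Dec (k ℕ.< n) → Measurable (λ x → k ℕ.< n × E k x)
      restrict k (yes k<n) = resp-≐ ((k<n ,_) , proj₂) (mE k)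
      restrict k (no k≮n)  = resp-≐ ((λ ()) , λ (k<n , _) → ⊥-elim (k≮n k<n)) measurable-∅

    D : ℕ → Pred X 0ℓ
    D n = A ∩ (E n ∩ Before n)

    mD : ∀ n → Measurable (D n)
    mD n = measurable-∩ mA (measurable-∩ (mE n) (mBefore n))

    disjoint : ∀ i j → i ≢ j → D i ⊥ D j
    disjoint i j i≢j ((_ , x∈Ei , beforei) , (_ , x∈Ej , beforej)) with ℕ.<-cmp i j
    ... | tri< i<j _ _ = beforej i i<j x∈Ei
    ... | tri≈ _ i≡j _ = i≢j i≡j
    ... | tri> _ _ j<i = beforei j j<i x∈Ej

    A⊆⋃D : A ⊆ ⋃ ℕ D
    A⊆⋃D {x} x∈A =
      let m , x∈Em = A⊆⋃E x∈A
          -- `Before 0` is vacuous and `Before (suc m)` fails, as `x` lies in `E m`; where `Before`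
          -- breaks from `n` to `suc n`, the new index `n` must be the culprit.
          n , before , ¬before = first-failure (λ n → Before n x) (suc m) (λ _ ())
            (λ before → before m (ℕ.n<1+n m) x∈Em)
      in n , x∈A , ¬¬-elim (λ x∉En → ¬before λ k k<1+n x∈Ek → case x∉En before x∈Ek (ℕ.m<1+n⇒m<n∨m≡n k<1+n)) , before
      where
      case : ∀ {n k} → ¬ E n x → Before n x → E k x → ¬ (k ℕ.< n ⊎ k ≡ n)
      case x∉En before x∈Ek (inj₁ k<n)  = before _ k<n x∈Ek
      case x∉En before x∈Ek (inj₂ refl) = x∉En x∈Ek

  -- A block on which a simple function below `g` has a positive value lies inside `N`, so its
  -- measure is 0; every other block has value 0.
  ∫-null : ∀ {N g} → Null N → (∀ x → ¬ N x → g x ≼ 0#) → ∫ g ≼ 0#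
  ∫-null {N} {g} nullN g≼0 = ∫≼ g λ s s≼g → let open Simple s in
    subst (_≼ 0#) (sym (integral≡∑ s)) (∑-null term (λ i → term≼0 s s≼g i))
    where
    term≼0 : ∀ s → (∀ x → SimpleFunction.eval s x ≼ g x) → ∀ i → Simple.term s i ≼ 0#
    term≼0 s s≼g i with lem {⟨ SimpleFunction.value s i ⟩ ≼ 0#}
    ... | yes v≼0 = ≼-trans (·-monoˡ v≼0) (proj₁ (·-zeroˡ _))
    ... | no 0≺v  = ≼-trans (·-monoʳ (nullN (SimpleFunction.fibre s i) fibre⊆N)) (proj₁ (·-zeroʳ _))
      where
      fibre⊆N : (λ x → SimpleFunction.label s x ≡ i) ⊆ N
      fibre⊆N {x} refl = ¬¬-elim λ x∉N → 0≺v (≼-trans (s≼g x) (g≼0 x x∉N))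

  module _ {A : Pred X 0ℓ} (mA : Measurable A) {q : ℚ} (0≤q : 0ℚ ℚ.≤ q) where
    private
      decide : ∀ {P : Set} → Dec P → Fin 2
      decide (yes _) = zero
      decide (no _)  = suc zero

      indicator-label : X → Fin 2
      indicator-label x = decide (lem {A x})

      zero⇔∈ : (λ x → indicator-label x ≡ zero) ≐ A
      zero⇔∈ = to , from
        where
        to : ∀ {x} → indicator-label x ≡ zero → A x
        to {x} eq with lem {A x}
        ... | yes x∈A = x∈A
        from : ∀ {x} → A x → indicator-label x ≡ zero
        from {x} x∈A with lem {A x}
        ... | yes _  = refl
        ... | no x∉A = ⊥-elim (x∉A x∈A)

      one⇔∉ : (λ x → indicator-label x ≡ suc zero) ≐ ∁ A
      one⇔∉ = to , from
        where
        to : ∀ {x} → indicator-label x ≡ suc zero → ¬ A x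
        to {x} eq with lem {A x}
        ... | no x∉A = x∉A
        from : ∀ {x} → ¬ A x → indicator-label x ≡ suc zero
        from {x} x∉A with lem {A x}
        ... | yes x∈A = ⊥-elim (x∉A x∈A)
        ... | no _    = refl

    indicator : SimpleFunction
    indicator = record
      { size    = 2
      ; label   = indicator-label
      ; fibre   = λ where
          zero       → resp-≐ (swap zero⇔∈) mA
          (suc zero) → resp-≐ (swap one⇔∉) (complement mA)
      ; value   = λ where
          zero       → q
          (suc zero) → 0ℚ
      ; value≥0 = λ where
          zero       → 0≤q
          (suc zero) → ℚ.≤-refl
      }

    -- The left side is one term of the integral of `q` times the indicator of `A`, a simple
    -- function below `g`.
    markov : ∀ {g} → (∀ {x} → A x → ⟨ q ⟩ ≼ g x) → ⟨ q ⟩ · μ A mA ≼ ∫ g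
    markov {g} q≼g = begin
      ⟨ q ⟩ · μ A mA                    ≈⟨ ·-congˡ (≈⇒≋ _ _ (μ-cong mA (SimpleFunction.fibre indicator zero) (swap zero⇔∈))) ⟩
      Simple.term indicator zero        ≤⟨ ≼∑ (Simple.term indicator) zero ⟩
      ∑ (Simple.term indicator)         ≡⟨ integral≡∑ indicator ⟨
      SimpleFunction.integral indicator ≤⟨ integral≼∫ indicator g indicator≼g ⟩
      ∫ g                               ∎
      where
      indicator≼g : ∀ x → SimpleFunction.eval indicator x ≼ g x
      indicator≼g x with lem {A x}
      ... | yes x∈A = q≼g x∈A
      ... | no _    = 0≼

  null-superlevel : ∀ {g q} → 0ℚ ℚ.< q → ∫ g ≼ 0# → Null (λ x → ⟨ q ⟩ ≼ g x)
  null-superlevel {g} {q} 0<q ∫g≼0 {A} mA A⊆ = ·-cancelʳ-≼ (⟨⟩-unit 0<q) (begin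
    μ A mA · ⟨ q ⟩  ≈⟨ ·-comm (μ A mA) ⟨ q ⟩ ⟩
    ⟨ q ⟩ · μ A mA  ≤⟨ markov mA (ℚ.<⇒≤ 0<q) {g} A⊆ ⟩
    ∫ g             ≤⟨ ∫g≼0 ⟩
    0#              ≈⟨ ·-zeroˡ ⟨ q ⟩ ⟨
    0# · ⟨ q ⟩      ∎)

  null-positive : ∀ {p f} → Unit p → MeasurableFunction f → ∫ (λ x → f x ↑ p) ≼ 0# → Null (λ x → 0# ≺ f x)
  null-positive {p} {f} p-unit mf ∫fᵖ≼0 {A} mA A⊆ =
    null-⋃ E (λ n → measurable-≺ mf ⟨ frac 1 n ⟩) nullE mA (λ x∈A → archimedes (A⊆ x∈A))
    where
    E : ℕ → Pred X 0ℓ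
    E n x = ⟨ frac 1 n ⟩ ≺ f x
    nullE : ∀ n → Null (E n)
    nullE n mB B⊆E =
      -- `null-superlevel` takes a rational level, whereas the power of `1/(n+1)` is in general
      -- real, so a positive rational below it is used.
      let q , 0<q , _ , q≺εᵖ = ≺-dense (↑-positive p-unit (proj₁ (⟨⟩-unit (frac-pos 0 n))))
      in null-superlevel 0<q ∫fᵖ≼0 mB λ x∈B →
           ≼-trans (≺⇒≼ q≺εᵖ) (↑-mono p-unit (≺⇒≼ (B⊆E x∈B)))
    archimedes : ∀ {x} → 0# ≺ f x → ⋃ ℕ E x
    archimedes {x} 0≺fx =
      let q , 0<q , _ , q≺fx = ≺-dense 0≺fx
          m , k , q≡ = pos-frac 0<q
          -- With `q = (m+1)/(k+1)`, the denominator gives the index: `1/(k+1) ≤ q < f x`.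
          1/k≤q = subst (frac 1 k ℚ.≤_) (sym q≡)
            (frac-mono {1} {k} {suc m} {k} (ℕ.*-monoˡ-≤ (suc k) {1} {suc m} (ℕ.s≤s ℕ.z≤n)))
      in k , ≼-≺-trans (⟨⟩-mono 1/k≤q) q≺fx

  -- Division and softmax

  open Softmax lem M using (_⊸_)

  opaque
    unfolding _≼_

    ⊸-null : ∀ {a} b → a ≋ 0# → a ⊸ b ≡ ∞#
    ⊸-null {a} b a≋0 with lem {a ≈ 0#}
    ... | yes _  = refl
    ... | no a≉0 = ⊥-elim (a≉0 a≋0)

    ⊸-infinite : ∀ a {b} → b ≋ ∞# → a ⊸ b ≡ ∞#
    ⊸-infinite a {b} b≋∞ with lem {a ≈ 0#} | lem {b ≈ ∞#}
    ... | yes _ | _      = refl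
    ... | no _  | yes _  = refl
    ... | no _  | no b≉∞ = ⊥-elim (b≉∞ b≋∞)

    -- The formula also covers the branch `a = ∞`, since `b · ∞ ⁻¹ = b · 0 = 0`.
    ⊸-finite : ∀ {a b} → 0# ≺ a → b ≺ ∞# → a ⊸ b ≋ b · a ⁻¹
    ⊸-finite {a} {b} 0≺a b≺∞ with lem {a ≈ 0#} | lem {b ≈ ∞#} | lem {a ≈ ∞#}
    ... | yes a≋0 | _       | _       = ⊥-elim (0≺a (proj₁ a≋0))
    ... | no _    | yes b≋∞ | _       = ⊥-elim (b≺∞ (proj₂ b≋∞))
    ... | no _    | no _    | no _    = ≋-refl {b · a ⁻¹}
    ... | no _    | no _    | yes a≋∞ =
      ≋-sym {b · a ⁻¹} {0#} (≋-trans {b · a ⁻¹} {b · 0#} {0#}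
        (·-cong {b} {b} {a ⁻¹} {0#} (≋-refl {b}) (≋-trans {a ⁻¹} {∞# ⁻¹} {0#} (⁻¹-cong {a} {∞#} a≋∞) ∞⁻¹)) (·-zeroʳ b))

  -- For invertible `b` the formula extends to `a = 0`, because `b · ∞ = ∞`; for `b = 0` it would
  -- give 0 where `0 ⊸ 0` is `∞`.
  ⊸-unit : ∀ a {b} → Unit b → a ⊸ b ≋ b · a ⁻¹
  ⊸-unit a {b} (0≺b , b≺∞) with lem {a ≼ 0#}
  ... | no 0≺a  = ⊸-finite 0≺a b≺∞
  ... | yes a≼0 = begin-equality
    a ⊸ b      ≡⟨ ⊸-null b (a≼0 , 0≼) ⟩
    ∞#         ≈⟨ ·∞ 0≺b ⟨
    b · ∞#     ≈⟨ ·-congˡ (≋-trans (⁻¹-cong (a≼0 , 0≼)) 0⁻¹) ⟨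
    b · a ⁻¹   ∎

  ⊸-congˡ : ∀ {a a′} b → a ≋ a′ → a ⊸ b ≋ a′ ⊸ b
  ⊸-congˡ {a} {a′} b a≋a′ with lem {∞# ≼ b} | lem {a ≼ 0#}
  ... | yes ∞≼b | _ = subst₂ _≋_ (sym (⊸-infinite a (≼∞ , ∞≼b))) (sym (⊸-infinite a′ (≼∞ , ∞≼b))) ≋-refl
  ... | no _ | yes a≼0 = subst₂ _≋_ (sym (⊸-null b (a≼0 , 0≼)))
    (sym (⊸-null b (≼-trans (proj₂ a≋a′) a≼0 , 0≼))) ≋-refl
  ... | no b≺∞ | no 0≺a = begin-equality
    a ⊸ b      ≈⟨ ⊸-finite 0≺a b≺∞ ⟩
    b · a ⁻¹   ≈⟨ ·-congˡ (⁻¹-cong a≋a′) ⟩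
    b · a′ ⁻¹  ≈⟨ ⊸-finite (≺-≼-trans 0≺a (proj₁ a≋a′)) b≺∞ ⟨
    a′ ⊸ b     ∎

  1≼⊸⇒≼ : ∀ a b → 1# ≼ a ⊸ b → a ≼ b
  1≼⊸⇒≼ a b 1≼a⊸b with lem {∞# ≼ b} | magnitude a
  ... | yes ∞≼b | _            = ≼-trans ≼∞ ∞≼b
  ... | no _    | null a≋0     = ≼-trans (proj₁ a≋0) 0≼
  ... | no b≺∞  | unit u       = begin
    a       ≈⟨ ·-identityˡ a ⟨
    1# · a  ≤⟨ ≼·⁻¹⇒·≼ u (≼-trans 1≼a⊸b (proj₁ (⊸-finite (proj₁ u) b≺∞))) ⟩
    b       ∎
  ... | no b≺∞  | infinite a≋∞ = ⊥-elim (proj₁ 1-unit (begin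
    1#        ≤⟨ 1≼a⊸b ⟩
    a ⊸ b     ≈⟨ ⊸-finite (≺-≼-trans (≺-≼-trans (proj₁ 1-unit) ≼∞) (proj₂ a≋∞)) b≺∞ ⟩
    b · a ⁻¹  ≈⟨ ·-congˡ (≋-trans (⁻¹-cong a≋∞) ∞⁻¹) ⟩
    b · 0#    ≈⟨ ·-zeroʳ b ⟩
    0#        ∎))

  ≼⇒1≼⊸ : ∀ a b → a ≼ b → 1# ≼ a ⊸ b
  ≼⇒1≼⊸ a b a≼b with lem {∞# ≼ b} | lem {a ≼ 0#}
  ... | yes ∞≼b | _       = subst (1# ≼_) (sym (⊸-infinite a (≼∞ , ∞≼b))) ≼∞
  ... | no _    | yes a≼0 = subst (1# ≼_) (sym (⊸-null b (a≼0 , 0≼))) ≼∞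
  ... | no b≺∞  | no 0≺a  = begin
    1#        ≤⟨ ·≼⇒≼·⁻¹ (0≺a , ≼-≺-trans a≼b b≺∞) (≼-trans (proj₁ (·-identityˡ a)) a≼b) ⟩
    b · a ⁻¹  ≈⟨ ⊸-finite 0≺a b≺∞ ⟨
    a ⊸ b     ∎

  -- The soft universal quantifier, by the size of `b`

  module _ {f : X → [0,∞]} (mf : MeasurableFunction f) {p : [0,∞]} (p-unit : Unit p) where

    private
      p⁻¹-unit : Unit (p ⁻¹)
      p⁻¹-unit = ⁻¹-unit p-unit

    -- Off the null set where `f` is positive, `0 ⊸ b = ∞`, and the integrand is 0.
    ∫⊸-null : ∀ {b} → b ≋ 0# → ∫ (λ x → f x ↑ p) ≼ 0# → ∫ (λ x → ((f x ⊸ b) ⁻¹) ↑ p) ≼ 0#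
    ∫⊸-null {b} b≋0 J≼0 = ∫-null (null-positive p-unit mf J≼0) λ x fx≼0 → begin
      ((f x ⊸ b) ⁻¹) ↑ p  ≡⟨ cong (λ a → (a ⁻¹) ↑ p) (⊸-null b (¬¬-elim fx≼0 , 0≼)) ⟩
      (∞# ⁻¹) ↑ p         ≈⟨ ↑-cong p-unit ∞⁻¹ ⟩
      0# ↑ p              ≈⟨ 0↑ p-unit ⟩
      0#                  ∎

    -- The integrand dominates `∞ · f^p`: both vanish where `f` does, and the integrand is `∞`
    -- elsewhere. Moving `∞` out of the integral leaves `∞ · ∫ f^p = ∞`.
    ∫⊸-positive : ∀ {b} → b ≋ 0# → 0# ≺ ∫ (λ x → f x ↑ p) → ∞# ≼ ∫ (λ x → ((f x ⊸ b) ⁻¹) ↑ p)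
    ∫⊸-positive {b} b≋0 0≺J = begin
      ∞#                               ≈⟨ ∞· 0≺J ⟨
      ∞# · ∫ (λ x → f x ↑ p)           ≤⟨ ·∫≼∫· ∞# (λ x → f x ↑ p) ⟩
      ∫ (λ x → ∞# · f x ↑ p)           ≤⟨ ∫-mono pointwise ⟩
      ∫ (λ x → ((f x ⊸ b) ⁻¹) ↑ p)     ∎
      where
      pointwise : ∀ x → ∞# · f x ↑ p ≼ ((f x ⊸ b) ⁻¹) ↑ p
      pointwise x with lem {f x ≼ 0#}
      ... | yes fx≼0 = begin
        ∞# · f x ↑ p    ≈⟨ ·-congˡ (≋-trans (↑-cong p-unit (fx≼0 , 0≼)) (0↑ p-unit)) ⟩
        ∞# · 0#         ≈⟨ ·-zeroʳ ∞# ⟩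
        0#              ≤⟨ 0≼ ⟩
        ((f x ⊸ b) ⁻¹) ↑ p ∎
      ... | no 0≺fx = begin
        ∞# · f x ↑ p        ≤⟨ ≼∞ ⟩
        ∞#                  ≈⟨ ∞↑ p-unit ⟨
        ∞# ↑ p              ≈⟨ ↑-cong p-unit (≋-trans (⁻¹-cong ⊸≋0) 0⁻¹) ⟨
        ((f x ⊸ b) ⁻¹) ↑ p  ∎
        where
        ⊸≋0 : f x ⊸ b ≋ 0#
        ⊸≋0 = begin-equality
          f x ⊸ b        ≈⟨ ⊸-finite 0≺fx (≼-≺-trans (≼-trans (proj₁ b≋0) 0≼) (proj₂ 1-unit)) ⟩
          b · f x ⁻¹     ≈⟨ ·-congʳ b≋0 ⟩
          0# · f x ⁻¹    ≈⟨ ·-zeroˡ (f x ⁻¹) ⟩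
          0#             ∎

    ∫⊸-unit : ∀ {b} → Unit b → ∫ (λ x → ((f x ⊸ b) ⁻¹) ↑ p) ≋ ∫ (λ x → f x ↑ p) · (b ↑ p) ⁻¹
    ∫⊸-unit {b} ub = ≋-trans (∫-cong pointwise) (∫-· (λ x → f x ↑ p) (⁻¹-unit (↑-unit p-unit ub)))
      where
      pointwise : ∀ x → ((f x ⊸ b) ⁻¹) ↑ p ≋ f x ↑ p · (b ↑ p) ⁻¹
      pointwise x = begin-equality
        ((f x ⊸ b) ⁻¹) ↑ p         ≈⟨ ↑-cong p-unit (⁻¹-cong (≋-trans (⊸-unit (f x) ub) (·-comm b (f x ⁻¹)))) ⟩
        ((f x ⁻¹ · b) ⁻¹) ↑ p      ≈⟨ ↑-cong p-unit (⁻¹-distrib-· (f x ⁻¹) ub) ⟩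
        (f x ⁻¹ ⁻¹ · b ⁻¹) ↑ p     ≈⟨ ↑-cong p-unit (·-congʳ (⁻¹-involutive (f x))) ⟩
        (f x · b ⁻¹) ↑ p           ≈⟨ ↑-· p-unit (f x) (⁻¹-unit ub) ⟩
        f x ↑ p · (b ⁻¹) ↑ p       ≈⟨ ·-congˡ (↑-⁻¹ p-unit b) ⟩
        f x ↑ p · (b ↑ p) ⁻¹       ∎

    soft-universal : ∀ b → (∫ (λ x → ((f x ⊸ b) ⁻¹) ↑ p)) ⁻¹ ↑ p ⁻¹ ≋ (∫ (λ x → f x ↑ p)) ↑ p ⁻¹ ⊸ b
    soft-universal b = by-magnitude (magnitude b)
      where
      J H : [0,∞]
      J = ∫ (λ x → f x ↑ p)
      H = ∫ (λ x → ((f x ⊸ b) ⁻¹) ↑ p)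

      H-null : H ≼ 0# → H ⁻¹ ↑ p ⁻¹ ≋ ∞#
      H-null H≼0 = ≋-trans (↑-cong p⁻¹-unit (≋-trans (⁻¹-cong (H≼0 , 0≼)) 0⁻¹)) (∞↑ p⁻¹-unit)

      by-magnitude : Magnitude b → H ⁻¹ ↑ p ⁻¹ ≋ J ↑ p ⁻¹ ⊸ b
      by-magnitude (infinite b≋∞) = begin-equality
        H ⁻¹ ↑ p ⁻¹     ≈⟨ H-null (∫-null null-∅ λ x _ → begin
          ((f x ⊸ b) ⁻¹) ↑ p  ≡⟨ cong (λ a → (a ⁻¹) ↑ p) (⊸-infinite (f x) b≋∞) ⟩
          (∞# ⁻¹) ↑ p         ≈⟨ ↑-cong p-unit ∞⁻¹ ⟩
          0# ↑ p              ≈⟨ 0↑ p-unit ⟩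
          0#                  ∎) ⟩
        ∞#              ≡⟨ ⊸-infinite (J ↑ p ⁻¹) b≋∞ ⟨
        J ↑ p ⁻¹ ⊸ b    ∎
      by-magnitude (unit ub) = begin-equality
        H ⁻¹ ↑ p ⁻¹                        ≈⟨ ↑-cong p⁻¹-unit (⁻¹-cong (∫⊸-unit ub)) ⟩
        (J · (b ↑ p) ⁻¹) ⁻¹ ↑ p ⁻¹         ≈⟨ ↑-cong p⁻¹-unit (⁻¹-distrib-· J (⁻¹-unit (↑-unit p-unit ub))) ⟩
        (J ⁻¹ · (b ↑ p) ⁻¹ ⁻¹) ↑ p ⁻¹      ≈⟨ ↑-cong p⁻¹-unit (·-congˡ (⁻¹-involutive (b ↑ p))) ⟩
        (J ⁻¹ · b ↑ p) ↑ p ⁻¹              ≈⟨ ↑-· p⁻¹-unit (J ⁻¹) (↑-unit p-unit ub) ⟩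
        J ⁻¹ ↑ p ⁻¹ · (b ↑ p) ↑ p ⁻¹       ≈⟨ ·-cong (↑-⁻¹ p⁻¹-unit J) (↑-inverse p-unit b) ⟩
        (J ↑ p ⁻¹) ⁻¹ · b                  ≈⟨ ·-comm ((J ↑ p ⁻¹) ⁻¹) b ⟩
        b · (J ↑ p ⁻¹) ⁻¹                  ≈⟨ ⊸-unit (J ↑ p ⁻¹) ub ⟨
        J ↑ p ⁻¹ ⊸ b                       ∎
      by-magnitude (null b≋0) with lem {J ≼ 0#}
      -- Both sides are `∞`: the left one because the integral `H` vanishes, the right one by the
      -- convention `0 ⊸ 0 = ∞`.
      ... | yes J≼0 = begin-equality
        H ⁻¹ ↑ p ⁻¹     ≈⟨ H-null (∫⊸-null b≋0 J≼0) ⟩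
        ∞#              ≡⟨ ⊸-null b (≋-trans (↑-cong p⁻¹-unit (J≼0 , 0≼)) (0↑ p⁻¹-unit)) ⟨
        J ↑ p ⁻¹ ⊸ b    ∎
      ... | no 0≺J = begin-equality
        H ⁻¹ ↑ p ⁻¹            ≈⟨ ↑-cong p⁻¹-unit (≋-trans (⁻¹-cong (≼∞ , ∫⊸-positive b≋0 0≺J)) ∞⁻¹) ⟩
        0# ↑ p ⁻¹              ≈⟨ 0↑ p⁻¹-unit ⟩
        0#                     ≈⟨ ·-zeroˡ ((J ↑ p ⁻¹) ⁻¹) ⟨
        0# · (J ↑ p ⁻¹) ⁻¹     ≈⟨ ·-congʳ b≋0 ⟨
        b · (J ↑ p ⁻¹) ⁻¹      ≈⟨ ⊸-finite (↑-positive p⁻¹-unit 0≺J)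
                                    (≼-≺-trans (≼-trans (proj₁ b≋0) 0≼) (proj₂ 1-unit)) ⟨
        J ↑ p ⁻¹ ⊸ b           ∎

  softmax-one : ∀ f b → (∫ (λ x → f x ↑ 1#)) ↑ 1# ⁻¹ ⊸ b ≋ ∫ f ⊸ b
  softmax-one f b = ⊸-congˡ b (≋-trans (↑-identity (⁻¹-unit 1-unit) 1⁻¹ (∫ (λ x → f x ↑ 1#)))
    (∫-cong λ x → ↑-identity 1-unit ≋-refl (f x)))

opaque
  unfolding _≼_

  mainTheorem1 : (lem : ExcludedMiddle 0ℓ) (M : MeasureSpace) →
    let open MeasureSpace M using (X)
        open Softmax lem M
    in (f : X → [0,∞]) → MeasurableFunction f →
       ((p : [0,∞]) → 0# < p → p < ∞# → (x* : X) →
          p-softmax p f x* ≈ ((∫ λ x → f x ^ p) ^ p *) ⊸ f x*)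
     × ((x* : X) → p-softmax 1# f x* ≈ softmax f x*)
     × ((x* : X) → ⌊ ∞-softmax f x* ⌋ ⇔ argmax f x*)
  mainTheorem1 lem M f mf =
    -- With the opaque copies unfolded, the two bounds on `p` form a `Unit p`, and the claim is
    -- `soft-universal` at `b = f x*`.
    (λ p 0<p p<∞ x* → soft-universal mf {p} (0<p , p<∞) (f x*)) ,
    (λ x* → ≋-trans {p-softmax 1# f x*} {(∫ λ x → f x ^ 1#) ^ 1# * ⊸ f x*} {softmax f x*}
      (soft-universal mf {1#} 1-unit (f x*)) (softmax-one f (f x*))) ,
    (λ x* → mk⇔
      (λ 1≤⋀ x → 1≼⊸⇒≼ (f x) (f x*) (≼-trans {1#} {∞-softmax f x*} {f x ⊸ f x*} 1≤⋀ (⋀≼ (λ x → f x ⊸ f x*) x)))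
      (λ max → ≼⋀ (λ x → f x ⊸ f x*) {1#} λ x → ≼⇒1≼⊸ (f x) (f x*) (max x)))
    where
    open Softmax lem M
    open Measure lem M
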